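{- The Strongly Connected Steiner Subgraph (SCSS) problem can be solved in $O^*(2^n)$ time, where $n=|V|$ is the number of vertices of the input directed graph $D=(V,A)$.
   Context: Strongly Connected Steiner Subgraph (SCSS): the input is a directed graph $D=(V,A)$, a set of terminals $T\subseteq V$, and an integer $t$. The question is whether there is a set $X\subseteq A$ with $|X|\le t$ such that for all $u,v\in T$ there is a directed path from $u$ to $v$ formed by arcs of $X$. The notation $O^*(\cdot)$ hides factors polynomial in the input size. -}

module Defs where

open import Data.Bool using (Bool; true; false; if_then_else_)
open import Data.Fin using (Fin)
open import Data.Fin.Subset using (Subset; _∈_; _⊆_; ∣_∣)
open import Data.Integer as ℤ using (ℤ; +_; -[1+_])
open import Data.List using (List; []; _∷_; _++_; map; sum)
open import Data.Nat using (ℕ; zero; suc; _+_; _∸_; _*_; _^_; _/_; _≤_; _≡ᵇ_)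
open import Data.Nat.Logarithm using (⌊log₂_⌋)
open import Data.Product using (∃-syntax; _×_)
open import Data.Sum using (_⊎_)
open import Data.Vec as Vec using (Vec; toList)
open import Relation.Binary.Construct.Closure.ReflexiveTransitive using (Star)
open import Relation.Binary.PropositionalEquality using (_≡_; _≢_)
open import Relation.Nullary using (¬_)

------------------------------------------------------------------------
-- Random access machines with logarithmic cost
--
-- The machine is the usual RAM over natural numbers (indirect addressing,
-- addition, truncated subtraction, multiplication, integer division, zero
-- test), presented by structured programs instead of jumps.  Time is the
-- logarithmic cost of Aho, Hopcroft and Ullman: every number that is
-- handled, addresses included, is charged its length in binary.

-- Number of binary digits, with len 0 = 1.
len : ℕ → ℕ
len n = suc ⌊log₂ n ⌋

-- Names of arrays.  A program mentions only finitely many of them, so they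
-- can be interleaved in the memory of a RAM with a single address space.
Name : Set
Name = ℕ

Store : Set
Store = Name → ℕ → ℕ

infix 9 _[_]
infixl 7 _⊗_ _⊘_
infixl 6 _⊕_ _⊖_

data Expr : Set where
  lit             : ℕ → Expr
  _[_]            : Name → Expr → Expr
  _⊕_ _⊖_ _⊗_ _⊘_ : Expr → Expr → Expr

infix  5 _[_]≔_
infixr 4 _⨾_

data Program : Set where
  skip           : Program
  _[_]≔_         : Name → Expr → Expr → Program
  _⨾_            : Program → Program → Program
  if_then_else′_ : Expr → Program → Program → Program
  while_loop_    : Expr → Program → Program

-- Division by zero yields zero.
_div_ : ℕ → ℕ → ℕ
m div zero    = 0
m div (suc n) = m / suc n

eval : Store → Expr → ℕ
eval σ (lit k)   = k
eval σ (a [ e ]) = σ a (eval σ e)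
eval σ (d ⊕ e)   = eval σ d + eval σ e
eval σ (d ⊖ e)   = eval σ d ∸ eval σ e
eval σ (d ⊗ e)   = eval σ d * eval σ e
eval σ (d ⊘ e)   = eval σ d div eval σ e

binaryCost : ℕ → ℕ → ℕ
binaryCost m n = len m + len n

cost : Store → Expr → ℕ
cost σ (lit k)   = len k
cost σ (a [ e ]) = cost σ e + (len (eval σ e) + len (σ a (eval σ e)))
cost σ (d ⊕ e)   = cost σ d + cost σ e + binaryCost (eval σ d) (eval σ e)
cost σ (d ⊖ e)   = cost σ d + cost σ e + binaryCost (eval σ d) (eval σ e)
cost σ (d ⊗ e)   = cost σ d + cost σ e + binaryCost (eval σ d) (eval σ e)
cost σ (d ⊘ e)   = cost σ d + cost σ e + binaryCost (eval σ d) (eval σ e)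

write : Store → Name → ℕ → ℕ → Store
write σ a i v b j =
  if a ≡ᵇ b then (if i ≡ᵇ j then v else σ b j) else σ b j

testCost : Store → Expr → ℕ
testCost σ e = cost σ e + len (eval σ e)

assignCost : Store → Expr → Expr → ℕ
assignCost σ d e =
  cost σ d + cost σ e + (len (eval σ d) + len (eval σ e))

-- p , σ ⇓[ s ] σ′ : started in store σ, the program p halts in store σ′
-- after time s.  The relation is deterministic; a nonzero test is true.

infix 3 _,_⇓[_]_

data _,_⇓[_]_ : Program → Store → ℕ → Store → Set where
  ⇓-skip   : ∀ {σ} → skip , σ ⇓[ 1 ] σ
  ⇓-assign : ∀ {σ a d e} →
    a [ d ]≔ e , σ ⇓[ assignCost σ d e ] write σ a (eval σ d) (eval σ e)
  ⇓-seq    : ∀ {p q σ σ′ σ″ r s} →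
    p , σ ⇓[ r ] σ′ → q , σ′ ⇓[ s ] σ″ → p ⨾ q , σ ⇓[ r + s ] σ″
  ⇓-true   : ∀ {e p q σ σ′ s} → eval σ e ≢ 0 → p , σ ⇓[ s ] σ′ →
    if e then p else′ q , σ ⇓[ testCost σ e + s ] σ′
  ⇓-false  : ∀ {e p q σ σ′ s} → eval σ e ≡ 0 → q , σ ⇓[ s ] σ′ →
    if e then p else′ q , σ ⇓[ testCost σ e + s ] σ′
  ⇓-stop   : ∀ {e p σ} → eval σ e ≡ 0 →
    while e loop p , σ ⇓[ testCost σ e ] σ
  ⇓-loop   : ∀ {e p σ σ′ σ″ r s} → eval σ e ≢ 0 →
    p , σ ⇓[ r ] σ′ → while e loop p , σ′ ⇓[ s ] σ″ →
    while e loop p , σ ⇓[ testCost σ e + (r + s) ] σ″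

------------------------------------------------------------------------
-- Decision problems and O*

record Problem : Set₁ where
  field
    Instance : Set
    encode   : Instance → List ℕ
    Yes      : Instance → Set

  -- Length of the input in bits.
  size : Instance → ℕ
  size I = sum (map len (encode I))

nth : List ℕ → ℕ → ℕ
nth []       i       = 0
nth (x ∷ xs) zero    = x
nth (x ∷ xs) (suc i) = nth xs i

-- Array 0 initially holds the input; every other cell is 0.
initial : List ℕ → Store
initial xs zero    i = nth xs i
initial xs (suc a) i = 0

-- The answer is left in cell 0 of array 1.
answer : Store → ℕ
answer σ = σ 1 0

DecidesInTime : (P : Problem) → Program → (Problem.Instance P → ℕ) → Set
DecidesInTime P p τ = ∀ I → ∃[ s ] ∃[ σ ]
    (p , initial (encode I) ⇓[ s ] σ)
  × s ≤ τ I
  × ((answer σ ≡ 1 × Yes I) ⊎ (answer σ ≡ 0 × ¬ Yes I))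
  where open Problem P

-- P is solvable in time O*(f), that is, f times a polynomial in the input
-- size.  Here size I ≥ 1 unless the encoding is empty, whence the suc.
SolvableInTimeO* : (P : Problem) → (Problem.Instance P → ℕ) → Set
SolvableInTimeO* P f = ∃[ p ] ∃[ c ] ∃[ k ]
  DecidesInTime P p (λ I → f I * (c * suc (size I) ^ k))
  where open Problem P

------------------------------------------------------------------------
-- Strongly Connected Steiner Subgraph

-- Sets of arcs on the vertex set Fin n, given by the set of out-neighbours
-- of each vertex.
ArcSet : ℕ → Set
ArcSet n = Vec (Subset n) n

module _ {n : ℕ} where

  Arc : ArcSet n → Fin n → Fin n → Set
  Arc X u v = v ∈ Vec.lookup X u

  _⊆ᴬ_ : ArcSet n → ArcSet n → Set
  X ⊆ᴬ A = ∀ u → Vec.lookup X u ⊆ Vec.lookup A u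

  ∣_∣ᴬ : ArcSet n → ℕ
  ∣ X ∣ᴬ = Vec.sum (Vec.map ∣_∣ X)

  Path : ArcSet n → Fin n → Fin n → Set
  Path X = Star (Arc X)

record SteinerInstance : Set where
  field
    order     : ℕ
    arcs      : ArcSet order
    terminals : Subset order
    budget    : ℤ

open SteinerInstance public

HasSolution : SteinerInstance → Set
HasSolution I = ∃[ X ]
    X ⊆ᴬ arcs I
  × + ∣ X ∣ᴬ ℤ.≤ budget I
  × (∀ u v → u ∈ terminals I → v ∈ terminals I → Path X u v)

bit : Bool → ℕ
bit false = 0
bit true  = 1

-- Sign bit followed by absolute value.
encodeℤ : ℤ → List ℕ
encodeℤ (+ k)    = 0 ∷ k ∷ []
encodeℤ -[1+ k ] = 1 ∷ suc k ∷ []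

-- The number of vertices, the budget, the characteristic vector of the
-- terminals, and the adjacency matrix row by row.
encodeSteiner : SteinerInstance → List ℕ
encodeSteiner I =
  order I ∷ encodeℤ (budget I) ++
  map bit (toList (terminals I) ++ toList (Vec.concat (arcs I)))

SCSS : Problem
SCSS = record
  { Instance = SteinerInstance
  ; encode   = encodeSteiner
  ; Yes      = HasSolution
  }

{-# OPTIONS --safe #-}

-- A strongly connected graph arises from a single vertex by adding ears, that
-- is, paths or cycles through new vertices that start and end in the old part.
-- An unfinished ear from the vertex set S, which has reached w and is to end
-- in v, only has to remember the triple (S, w, v), where S includes the new
-- vertices: once closed, S is strongly connected again.  Adding the number k
-- of arcs used so far yields 2ⁿ times polynomially many states (k, S, w, v),
-- and a solution exists if and only if some state with w = v, with all
-- terminals in S and with k within the budget can be reached.  Every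
-- transition increases k by one, so a single sweep through the states in
-- increasing order of their codes finds all that can be reached.

module Submission where

open import Defs
open import Data.Bool using (Bool; true; false; if_then_else_; T)
open import Data.Empty using (⊥-elim)
open import Data.Fin using (Fin; zero; suc; toℕ; fromℕ<)
import Data.Fin.Properties as Fin
open import Data.Fin.Subset using (Subset; _∈_; _∉_; _⊆_; ∣_∣; ⁅_⁆; ⊥; inside; outside)
open import Data.Fin.Subset.Properties
open import Data.Integer as ℤ using (ℤ; +_; -[1+_])
import Data.Integer.Properties as ℤ
open import Data.List as List using (List; []; _∷_; _++_)
import Data.List.Properties as List
open import Data.Nat
open import Data.Nat.DivMod hiding (_div_; _mod_)
open import Data.Nat.Divisibility using (n∣m*n)
open import Data.Nat.Induction using (<-wellFounded)
open import Data.Nat.ListAction using (sum)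
open import Data.Nat.Logarithm
open import Data.Nat.Properties
open import Data.Nat.Tactic.RingSolver using (solve-∀)
open import Data.Product
open import Data.Sum using (_⊎_; inj₁; inj₂; [_,_]′)
open import Data.Vec as Vec using (Vec; []; _∷_; lookup; replicate; toList)
import Data.Vec.Properties as Vec
open import Function using (_∘_; id)
open import Induction.WellFounded using (Acc; acc)
open import Relation.Binary.Construct.Closure.ReflexiveTransitive
  using (Star; ε; _◅_; _◅◅_; kleisliStar)
open import Relation.Binary.PropositionalEquality hiding ([_])
open import Relation.Nullary using (¬_; yes; no; Dec; contradiction)

-- Ears

-- The delicate direction is completeness: a solution X must yield a derivation with k at most the
-- number of arcs of X, although the hypothesis only provides walks, which may revisit vertices and
-- reuse arcs. Ears are cut out of closed walks from a fixed terminal to a missing one and back. At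
-- each new vertex x the walk is shortened to what follows its last visit to x, so no new vertex
-- recurs; and as all arcs counted before lie inside the old set, no arc is counted twice. A
-- derivation in general may count an arc repeatedly, which is harmless because soundness needs only
-- an upper bound.
--
-- As X has at most n² arcs, k can be limited to n². A state is handled in n² iterations, one for
-- each pair (a, b), whence (n² + 1) * 2 ^ n * n⁴ iterations in all.
--
-- On the machine, subsets are n-bit numbers, and n is at most the input size, so all stored numbers
-- have length linear in the input size. Conditions are evaluated by arithmetic instead of
-- branching, so one pass through a loop body costs a constant times that length.

infixl 6 _▸_

_▸_ : ∀ {n} → Subset n → Fin n → Subset n
S ▸ x = S Vec.[ x ]≔ inside

module _ {n : ℕ} {S : Subset n} where

  ∈-▸-new : ∀ x → x ∈ S ▸ x
  ∈-▸-new x = Vec.[]≔-updates S x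

  ∈-▸-old : ∀ {x y} → y ∈ S → y ∈ S ▸ x
  ∈-▸-old {x} {y} y∈S with y Fin.≟ x
  ... | yes refl = ∈-▸-new x
  ... | no  y≢x  = Vec.[]≔-minimal S y x y≢x y∈S

  ∈-▸⁻ : ∀ {x y} → y ∈ S ▸ x → y ≡ x ⊎ y ∈ S
  ∈-▸⁻ {x} {y} y∈ with y Fin.≟ x
  ... | yes y≡x = inj₁ y≡x
  ... | no  y≢x = inj₂ (Vec.lookup⇒[]= y S
          (trans (sym (Vec.lookup∘update′ y≢x S inside)) (Vec.[]=⇒lookup y∈)))

∣▸∣≤ : ∀ {n} (S : Subset n) x → ∣ S ▸ x ∣ ≤ suc ∣ S ∣
∣▸∣≤ (true  ∷ S) zero    = n≤1+n _
∣▸∣≤ (false ∷ S) zero    = ≤-refl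
∣▸∣≤ (true  ∷ S) (suc x) = s≤s (∣▸∣≤ S x)
∣▸∣≤ (false ∷ S) (suc x) = ∣▸∣≤ S x

∣▸∣≡ : ∀ {n} (S : Subset n) x → x ∉ S → ∣ S ▸ x ∣ ≡ suc ∣ S ∣
∣▸∣≡ (true  ∷ S) zero    x∉S = contradiction Vec.here x∉S
∣▸∣≡ (false ∷ S) zero    x∉S = refl
∣▸∣≡ (true  ∷ S) (suc x) x∉S = cong suc (∣▸∣≡ S x (x∉S ∘ Vec.there))
∣▸∣≡ (false ∷ S) (suc x) x∉S = ∣▸∣≡ S x (x∉S ∘ Vec.there)

-- The number of rows is kept apart from their length so that the counting lemmas below can go by
-- induction on the rows.
addArc : ∀ {m n} → Vec (Subset n) m → Fin m → Fin n → Vec (Subset n) m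
addArc X u v = Vec.updateAt X u (_▸ v)

∣addArc∣≤ : ∀ {m n} (X : Vec (Subset n) m) u v →
  Vec.sum (Vec.map ∣_∣ (addArc X u v)) ≤ suc (Vec.sum (Vec.map ∣_∣ X))
∣addArc∣≤ (R ∷ X) zero    v = +-monoˡ-≤ _ (∣▸∣≤ R v)
∣addArc∣≤ (R ∷ X) (suc u) v =
  ≤-trans (+-monoʳ-≤ ∣ R ∣ (∣addArc∣≤ X u v)) (≤-reflexive (+-suc ∣ R ∣ _))

∣addArc∣≡ : ∀ {m n} (X : Vec (Subset n) m) u v → v ∉ lookup X u →
  Vec.sum (Vec.map ∣_∣ (addArc X u v)) ≡ suc (Vec.sum (Vec.map ∣_∣ X))
∣addArc∣≡ (R ∷ X) zero    v v∉ = cong (_+ _) (∣▸∣≡ R v v∉)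
∣addArc∣≡ (R ∷ X) (suc u) v v∉ =
  trans (cong (λ m → ∣ R ∣ + m) (∣addArc∣≡ X u v v∉)) (+-suc ∣ R ∣ _)

∣∣ᴬ-mono : ∀ {m n} (X Y : Vec (Subset n) m) → (∀ u → lookup X u ⊆ lookup Y u) →
  Vec.sum (Vec.map ∣_∣ X) ≤ Vec.sum (Vec.map ∣_∣ Y)
∣∣ᴬ-mono []      []      X⊆Y = z≤n
∣∣ᴬ-mono (R ∷ X) (Q ∷ Y) X⊆Y =
  +-mono-≤ (p⊆q⇒∣p∣≤∣q∣ (X⊆Y zero)) (∣∣ᴬ-mono X Y (X⊆Y ∘ suc))

∣∣ᴬ≤m*n : ∀ {m n} (X : Vec (Subset n) m) → Vec.sum (Vec.map ∣_∣ X) ≤ m * n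
∣∣ᴬ≤m*n []      = z≤n
∣∣ᴬ≤m*n (R ∷ X) = +-mono-≤ (∣p∣≤n R) (∣∣ᴬ≤m*n X)

∣⊥∣ᴬ≡0 : ∀ m n → Vec.sum (Vec.map ∣_∣ (replicate m (⊥ {n}))) ≡ 0
∣⊥∣ᴬ≡0 zero    n = refl
∣⊥∣ᴬ≡0 (suc m) n = cong₂ _+_ (∣⊥∣≡0 n) (∣⊥∣ᴬ≡0 m n)

module _ {n : ℕ} {X : ArcSet n} where

  Arc-new : ∀ {u v} → Arc (addArc X u v) u v
  Arc-new {u} {v} =
    subst (v ∈_) (sym (Vec.lookup∘updateAt u X)) (∈-▸-new v)

  Arc-old : ∀ {u v p q} → Arc X p q → Arc (addArc X u v) p q
  Arc-old {u} {v} {p} {q} pq with p Fin.≟ u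
  ... | yes refl = subst (q ∈_) (sym (Vec.lookup∘updateAt u X)) (∈-▸-old pq)
  ... | no  p≢u  = subst (q ∈_) (sym (Vec.lookup∘updateAt′ p u p≢u X)) pq

  Arc⁻ : ∀ {u v p q} → Arc (addArc X u v) p q → (p ≡ u × q ≡ v) ⊎ Arc X p q
  Arc⁻ {u} {v} {p} {q} pq with p Fin.≟ u
  ... | no  p≢u  = inj₂ (subst (q ∈_) (Vec.lookup∘updateAt′ p u p≢u X) pq)
  ... | yes refl with ∈-▸⁻ (subst (q ∈_) (Vec.lookup∘updateAt u X) pq)
  ... | inj₁ q≡v = inj₁ (refl , q≡v)
  ... | inj₂ q∈  = inj₂ q∈

Arc-⊥ : ∀ {n} {u v : Fin n} → ¬ Arc (replicate n ⊥) u v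
Arc-⊥ {n} {u} {v} uv = ∉⊥ (subst (v ∈_) (Vec.lookup-replicate u ⊥) uv)

addArc-⊆ : ∀ {n} (X A : ArcSet n) u v → X ⊆ᴬ A → Arc A u v → addArc X u v ⊆ᴬ A
addArc-⊆ X A u v X⊆A uv p pq with Arc⁻ {X = X} pq
... | inj₁ (refl , refl) = uv
... | inj₂ pq′           = X⊆A p pq′

-- Der k S w v: some set of at most k arcs becomes strongly connected on S
-- once the virtual arc from w to v is added.  The states with w ≢ v
-- describe an unfinished ear, which has reached w and is to end in v.
data Der {n} (A : ArcSet n) : ℕ → Subset n → Fin n → Fin n → Set where
  start  : ∀ r → Der A 0 ⁅ r ⁆ r r
  extend : ∀ {k S w v x} → Der A k S w v → x ∉ S → Arc A w x →
           Der A (suc k) (S ▸ x) x v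
  close  : ∀ {k S w v a b} → Der A k S w v → Arc A w v → a ∈ S → b ∈ S →
           Der A (suc k) S a b

Accepting : SteinerInstance → Set
Accepting I = ∃[ k ] ∃[ S ] ∃[ w ]
  Der (arcs I) k S w w × terminals I ⊆ S × + k ℤ.≤ budget I

-- Soundness: from derivations to arc sets

module _ {n} {A : ArcSet n} where

  Der-ends : ∀ {k S w v} → Der A k S w v → w ∈ S × v ∈ S
  Der-ends (start r)       = x∈⁅x⁆ r , x∈⁅x⁆ r
  Der-ends (extend d _ _)  = ∈-▸-new _ , ∈-▸-old (proj₂ (Der-ends d))
  Der-ends (close _ _ a b) = a , b

  Virtual : ArcSet n → Fin n → Fin n → Fin n → Fin n → Set
  Virtual X w v p q = Arc X p q ⊎ (p ≡ w × q ≡ v)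

  -- Extending subdivides the virtual arc: the way from w to v now takes the real arc to x and then
  -- the virtual arc from x to v. Closing makes the virtual arc real, after which S is strongly
  -- connected by itself and the next virtual arc, from a to b, may be placed at will.
  Der-sound : ∀ {k S w v} → Der A k S w v →
    ∃[ X ] X ⊆ᴬ A × ∣ X ∣ᴬ ≤ k ×
      (∀ {p q} → p ∈ S → q ∈ S → Star (Virtual X w v) p q)
  Der-sound (start r) = replicate n ⊥ , (λ u → ⊥-elim ∘ Arc-⊥) ,
    ≤-reflexive (∣⊥∣ᴬ≡0 n n) , conn
    where
    conn : ∀ {p q} → p ∈ ⁅ r ⁆ → q ∈ ⁅ r ⁆ → Star (Virtual (replicate n ⊥) r r) p q
    conn p∈ q∈ with x∈⁅y⁆⇒x≡y r p∈ | x∈⁅y⁆⇒x≡y r q∈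
    ... | refl | refl = ε
  Der-sound (extend {S = S} {w} {v} {x} d x∉S wx) with Der-sound d
  ... | X , X⊆A , ∣X∣≤k , path =
    X′ , addArc-⊆ X A w x X⊆A wx , ≤-trans (∣addArc∣≤ X w x) (s≤s ∣X∣≤k) , conn
    where
    X′ = addArc X w x

    reroute : ∀ {p q} → Virtual X w v p q → Star (Virtual X′ x v) p q
    reroute (inj₁ pq)            = inj₁ (Arc-old {X = X} pq) ◅ ε
    reroute (inj₂ (refl , refl)) = inj₁ (Arc-new {X = X}) ◅ inj₂ (refl , refl) ◅ ε

    old : ∀ {p q} → p ∈ S → q ∈ S → Star (Virtual X′ x v) p q
    old p∈ q∈ = kleisliStar id reroute (path p∈ q∈)

    from-x : ∀ {q} → q ∈ S → Star (Virtual X′ x v) x q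
    from-x q∈ = inj₂ (refl , refl) ◅ old (proj₂ (Der-ends d)) q∈

    conn : ∀ {p q} → p ∈ S ▸ x → q ∈ S ▸ x → Star (Virtual X′ x v) p q
    conn p∈ q∈ with ∈-▸⁻ p∈ | ∈-▸⁻ q∈
    ... | inj₁ refl | inj₁ refl = ε
    ... | inj₁ refl | inj₂ q∈S  = from-x q∈S
    ... | inj₂ p∈S  | inj₁ refl =
      old p∈S (proj₁ (Der-ends d)) ◅◅ inj₁ (Arc-new {X = X}) ◅ ε
    ... | inj₂ p∈S  | inj₂ q∈S  = old p∈S q∈S
  Der-sound (close {w = w} {v} {a} {b} d wv a∈S b∈S) with Der-sound d
  ... | X , X⊆A , ∣X∣≤k , path =
    addArc X w v , addArc-⊆ X A w v X⊆A wv , ≤-trans (∣addArc∣≤ X w v) (s≤s ∣X∣≤k) ,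
    λ p∈ q∈ → kleisliStar id reroute (path p∈ q∈)
    where
    reroute : ∀ {p q} → Virtual X w v p q → Star (Virtual (addArc X w v) a b) p q
    reroute (inj₁ pq)            = inj₁ (Arc-old {X = X} pq) ◅ ε
    reroute (inj₂ (refl , refl)) = inj₁ (Arc-new {X = X}) ◅ ε

accepting⇒solution : ∀ I → Accepting I → HasSolution I
accepting⇒solution I (k , S , w , d , T⊆S , k≤b) with Der-sound d
... | X , X⊆A , ∣X∣≤k , path = X , X⊆A , ℤ.≤-trans (ℤ.+≤+ ∣X∣≤k) k≤b ,
  λ u v u∈T v∈T → kleisliStar id real (path (T⊆S u∈T) (T⊆S v∈T))
  where
  real : ∀ {p q} → Virtual {A = arcs I} X w w p q → Path X p q
  real (inj₁ pq)            = pq ◅ ε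
  -- In an accepting state the virtual arc is a loop, so paths can do without it.
  real (inj₂ (refl , refl)) = ε

-- Completeness: ears inside a solution

module _ {n} {A X : ArcSet n} (X⊆A : X ⊆ᴬ A) where

  -- These are walks, in which vertices may repeat. The length is an index because it is the measure
  -- by which the construction of an ear terminates.
  data Outside (U : Subset n) (v : Fin n) : ℕ → Fin n → Set where
    last : ∀ {y} → y ∉ U → Arc X y v → Outside U v 1 y
    cons : ∀ {ℓ y z} → y ∉ U → Arc X y z → Outside U v ℓ z → Outside U v (suc ℓ) y

  start∉ : ∀ {U v ℓ y} → Outside U v ℓ y → y ∉ U
  start∉ (last y∉U _)   = y∉U
  start∉ (cons y∉U _ _) = y∉U

  Departure : Subset n → Fin n → Fin n → ℕ → Set
  Departure U v x ℓ =
    Arc X x v ⊎ ∃[ ℓ′ ] ℓ′ < ℓ × ∃[ z ] Arc X x z × Outside (U ▸ x) v ℓ′ z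

  private
    ∉-▸ : ∀ {U : Subset n} {x y} → y ∉ U → y ≢ x → y ∉ U ▸ x
    ∉-▸ y∉U y≢x = [ y≢x , y∉U ]′ ∘ ∈-▸⁻

  -- The tail of the walk is searched before its head is compared with x. The departure found is
  -- therefore the one from the last visit, and the walk that follows it avoids x.
  lastVisit : ∀ {U v x ℓ y} → Outside U v ℓ y →
    Outside (U ▸ x) v ℓ y ⊎ Departure U v x ℓ
  lastVisit {x = x} {y = y} (last y∉U yv) with y Fin.≟ x
  ... | yes refl = inj₂ (inj₁ yv)
  ... | no  y≢x  = inj₁ (last (∉-▸ y∉U y≢x) yv)
  lastVisit {x = x} {y = y} (cons y∉U yz o) with lastVisit {x = x} o
  ... | inj₂ (inj₁ xv)             = inj₂ (inj₁ xv)
  ... | inj₂ (inj₂ (ℓ′ , lt , r))  = inj₂ (inj₂ (ℓ′ , m<n⇒m<1+n lt , r))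
  ... | inj₁ o′ with y Fin.≟ x
  ...   | yes refl = inj₂ (inj₂ (_ , ≤-refl , _ , yz , o′))
  ...   | no  y≢x  = inj₁ (cons (∉-▸ y∉U y≢x) yz o′)

  depart : ∀ {U v ℓ x} → Outside U v ℓ x → Departure U v x ℓ
  depart {x = x} o with lastVisit {x = x} o
  ... | inj₂ d  = d
  ... | inj₁ o′ = contradiction (∈-▸-new x) (start∉ o′)

  Within : Subset n → ArcSet n → Set
  Within U Y = ∀ {p q} → Arc Y p q → p ∈ U × q ∈ U

  -- The ends of the next ear are not known when the current one is closed, so derivations are kept
  -- for all pairs of ends. They share the count of arcs, since `close` leaves its two new ends
  -- free.
  record Closed (U : Subset n) : Set where
    field
      used   : ArcSet n
      used⊆X : used ⊆ᴬ X
      within : Within U used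
      der    : ∀ {a b} → a ∈ U → b ∈ U → Der A ∣ used ∣ᴬ U a b

  -- The arcs used so far lie within U, so the arcs into and out of the new
  -- vertex are unused, and each transition adds exactly one arc to Y.
  ear : ∀ {ℓ U u v x} Y → Acc _<_ ℓ → Outside U v ℓ x →
    u ∈ U → v ∈ U → Arc X u x → Y ⊆ᴬ X → Within U Y → Der A ∣ Y ∣ᴬ U u v →
    ∃[ U′ ] (U ▸ x) ⊆ U′ × Closed U′
  ear {U = U} {u} {v} {x} Y (acc rs) o u∈U v∈U ux Y⊆X YU d = continue (depart o)
    where
    x∉U : x ∉ U
    x∉U = start∉ o

    Y₁ = addArc Y u x

    Y₁⊆X : Y₁ ⊆ᴬ X
    Y₁⊆X = addArc-⊆ Y X u x Y⊆X ux

    within₁ : Within (U ▸ x) Y₁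
    within₁ pq with Arc⁻ {X = Y} pq
    ... | inj₁ (refl , refl) = ∈-▸-old u∈U , ∈-▸-new x
    ... | inj₂ pq′           = ∈-▸-old (proj₁ (YU pq′)) , ∈-▸-old (proj₂ (YU pq′))

    d₁ : Der A ∣ Y₁ ∣ᴬ (U ▸ x) x v
    d₁ = subst (λ k → Der A k (U ▸ x) x v)
           (sym (∣addArc∣≡ Y u x (x∉U ∘ proj₂ ∘ YU))) (extend d x∉U (X⊆A u ux))

    fresh : ¬ Arc Y₁ x v
    fresh xv with Arc⁻ {X = Y} xv
    ... | inj₁ (refl , _) = x∉U u∈U
    ... | inj₂ xv′        = x∉U (proj₁ (YU xv′))

    continue : Departure U v x _ → ∃[ U′ ] (U ▸ x) ⊆ U′ × Closed U′
    continue (inj₂ (ℓ′ , ℓ′<ℓ , z , xz , o′)) =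
      let U′ , sub , c = ear Y₁ (rs ℓ′<ℓ) o′ (∈-▸-new x) (∈-▸-old v∈U) xz Y₁⊆X within₁ d₁
      in U′ , sub ∘ ∈-▸-old , c
    continue (inj₁ xv) = U ▸ x , id , record
      { used   = addArc Y₁ x v
      ; used⊆X = addArc-⊆ Y₁ X x v Y₁⊆X xv
      ; within = within₂
      ; der    = λ {a} {b} a∈ b∈ → subst (λ k → Der A k (U ▸ x) a b)
                   (sym (∣addArc∣≡ Y₁ x v fresh)) (close d₁ (X⊆A x xv) a∈ b∈)
      }
      where
      within₂ : Within (U ▸ x) (addArc Y₁ x v)
      within₂ pq with Arc⁻ {X = Y₁} pq
      ... | inj₁ (refl , refl) = ∈-▸-new x , ∈-▸-old v∈U
      ... | inj₂ pq′           = within₁ pq′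

  leaving : ∀ {U p q} → Path X p q → p ∈ U → q ∉ U →
    ∃[ u ] ∃[ x ] u ∈ U × x ∉ U × Arc X u x × Path X x q
  leaving ε p∈ q∉ = contradiction p∈ q∉
  leaving {U} (_◅_ {j = y} py yq) p∈ q∉ with y ∈? U
  ... | yes y∈ = leaving yq y∈ q∉
  ... | no  y∉ = _ , y , p∈ , y∉ , py , yq

  entering : ∀ {U p q} → Path X p q → p ∉ U → q ∈ U →
    ∃[ ℓ ] ∃[ v ] v ∈ U × Outside U v ℓ p
  entering ε p∉ q∈ = contradiction q∈ p∉
  entering {U} (_◅_ {j = y} py yq) p∉ q∈ with y ∈? U
  ... | yes y∈ = 1 , y , y∈ , last p∉ py
  ... | no  y∉ = let ℓ , v , v∈ , o = entering yq y∉ q∈ in suc ℓ , v , v∈ , cons p∉ py o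

  module _ {T : Subset n} {r} (r∈T : r ∈ T)
           (linked : ∀ u v → u ∈ T → v ∈ T → Path X u v) where

    -- Each round adds an ear that contains at least one new vertex x, so the complement of U
    -- shrinks. The missing terminal t need not lie on that ear; it only forces some walk to leave
    -- U.
    cover : ∀ {U} → Acc _<_ (n ∸ ∣ U ∣) → r ∈ U → Closed U → ∃[ S ] T ⊆ S × Closed S
    cover {U} (acc rs) r∈U c with T ⊆? U
    ... | yes T⊆U = U , T⊆U , c
    ... | no  T⊈U with Fin.any? (λ t → missing? t)
      where
      missing? : ∀ t → Dec (t ∈ T × t ∉ U)
      missing? t with t ∈? T | t ∈? U
      ... | yes t∈ | no  t∉ = yes (t∈ , t∉)
      ... | yes _  | yes t∈ = no λ (_ , t∉) → t∉ t∈
      ... | no  t∉ | _      = no λ (t∈ , _) → t∉ t∈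
    ... | no  none = ⊥-elim (T⊈U covered)
      where
      covered : T ⊆ U
      covered {t} t∈T with t ∈? U
      ... | yes t∈U = t∈U
      ... | no  t∉U = contradiction (t , t∈T , t∉U) none
    ... | yes (t , t∈T , t∉U) with leaving (linked r t r∈T t∈T) r∈U t∉U
    -- The walk goes on to t and then back to r, which lies in U, so it must enter U again, at the
    -- end v of the ear.
    ... | u , x , u∈U , x∉U , ux , xt with entering (xt ◅◅ linked t r t∈T r∈T) x∉U r∈U
    ... | ℓ , v , v∈U , o with ear (Closed.used c) (<-wellFounded ℓ) o u∈U v∈U ux
                                  (Closed.used⊆X c) (Closed.within c) (Closed.der c u∈U v∈U)
    ... | U′ , U▸x⊆U′ , c′ =
      cover (rs (∸-monoʳ-< (p⊂q⇒∣p∣<∣q∣ (U⊆U′ , x , U▸x⊆U′ (∈-▸-new x) , x∉U)) (∣p∣≤n U′)))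
        (U⊆U′ r∈U) c′
      where
      U⊆U′ : U ⊆ U′
      U⊆U′ = U▸x⊆U′ ∘ ∈-▸-old

    singleton : Closed ⁅ r ⁆
    singleton = record
      { used   = replicate n ⊥
      ; used⊆X = λ u → ⊥-elim ∘ Arc-⊥
      ; within = ⊥-elim ∘ Arc-⊥
      ; der    = der₀
      }
      where
      der₀ : ∀ {a b} → a ∈ ⁅ r ⁆ → b ∈ ⁅ r ⁆ → Der A ∣ replicate n ⊥ ∣ᴬ ⁅ r ⁆ a b
      der₀ a∈ b∈ with x∈⁅y⁆⇒x≡y r a∈ | x∈⁅y⁆⇒x≡y r b∈
      ... | refl | refl = subst (λ k → Der A k ⁅ r ⁆ r r) (sym (∣⊥∣ᴬ≡0 n n)) (start r)

    spanning : ∃[ S ] T ⊆ S × Closed S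
    spanning = cover (<-wellFounded _) (x∈⁅x⁆ r) singleton

-- The bound on k places the accepting state within the range of the sweep. The given vertex is for
-- instances without terminals, where some singleton still has to serve as the accepting set.
solution⇒accepting : ∀ I → Fin (order I) → HasSolution I →
  ∃[ k ] k ≤ order I * order I × ∃[ S ] ∃[ w ]
    Der (arcs I) k S w w × terminals I ⊆ S × + k ℤ.≤ budget I
solution⇒accepting I r₀ (X , X⊆A , ∣X∣≤b , linked) with nonempty? (terminals I)
... | no  T≡∅ = 0 , z≤n , ⁅ r₀ ⁆ , r₀ , start r₀ , (λ t∈ → contradiction (_ , t∈) T≡∅) ,
  ℤ.≤-trans (ℤ.+≤+ z≤n) ∣X∣≤b
... | yes (r , r∈T) with spanning {A = arcs I} {X} X⊆A r∈T linked
... | S , T⊆S , c =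
  ∣ used ∣ᴬ , ∣∣ᴬ≤m*n used , S , r , der (T⊆S r∈T) (T⊆S r∈T) , T⊆S ,
  ℤ.≤-trans (ℤ.+≤+ (∣∣ᴬ-mono used X used⊆X)) ∣X∣≤b
  where open Closed c

-- Running times

n<2^len : ∀ n → n < 2 ^ len n
n<2^len n = ≰⇒> λ 2^≤n → 1+n≰n
  (≤-trans (≤-reflexive (sym (⌊log₂[2^n]⌋≡n (len n)))) (⌊log₂⌋-mono-≤ 2^≤n))

2*⌊n/2⌋≤n : ∀ n → 2 * ⌊ n /2⌋ ≤ n
2*⌊n/2⌋≤n n = ≤-trans
  (+-monoʳ-≤ ⌊ n /2⌋ (≤-trans (≤-reflexive (+-identityʳ _)) (⌊n/2⌋≤⌈n/2⌉ n)))
  (≤-reflexive (⌊n/2⌋+⌈n/2⌉≡n n))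

-- Halving n lowers both sides by one. The exponent is a successor because the claim fails for
-- exponent 0: `len 0` is 1.
n<2^[1+l]⇒len≤ : ∀ l {n} → n < 2 ^ suc l → len n ≤ suc l
n<2^[1+l]⇒len≤ zero    {0}    _ = ≤-refl
n<2^[1+l]⇒len≤ zero    {1}    _ = ≤-refl
n<2^[1+l]⇒len≤ zero    {2+ n} (s≤s (s≤s ()))
n<2^[1+l]⇒len≤ (suc l) {n}    n< =
  s≤s (≤-trans (m≤n+m∸n ⌊log₂ n ⌋ 1) (s≤s (≤-trans
    (≤-reflexive (sym (⌊log₂⌊n/2⌋⌋≡⌊log₂n⌋∸1 n)))
    (s≤s⁻¹ (n<2^[1+l]⇒len≤ l (*-cancelˡ-< 2 ⌊ n /2⌋ (2 ^ suc l)
      (≤-<-trans (2*⌊n/2⌋≤n n) n<)))))))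

len-mono : ∀ {m n} → m ≤ n → len m ≤ len n
len-mono m≤n = s≤s (⌊log₂⌋-mono-≤ m≤n)

len-* : ∀ m n → len (m * n) ≤ len m + len n
len-* m n = n<2^[1+l]⇒len≤ _ (<-≤-trans
  (*-mono-< (n<2^len m) (n<2^len n))
  (≤-reflexive (sym (^-distribˡ-+-* 2 (len m) (len n)))))

-- A sum of two numbers that are at least 2 is at most their product, and 2 to the power of a length
-- is at least 2. This crude bound has the same shape as that for products, so all operations can be
-- charged alike.
len-+ : ∀ m n → len (m + n) ≤ len m + len n
len-+ m n = n<2^[1+l]⇒len≤ _ (<-≤-trans (+-mono-< (n<2^len m) (n<2^len n))
  (≤-trans sum≤product (≤-reflexive (sym (^-distribˡ-+-* 2 (len m) (len n))))))
  where
  p = 2 ^ ⌊log₂ m ⌋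
  q = 2 ^ ⌊log₂ n ⌋

  sum≤product : 2 * p + 2 * q ≤ 2 * p * (2 * q)
  sum≤product = ≤-trans
    (+-mono-≤ (*-monoʳ-≤ 2 (m≤m*n p q {{m^n≢0 2 ⌊log₂ n ⌋}}))
              (*-monoʳ-≤ 2 (m≤n*m q p {{m^n≢0 2 ⌊log₂ m ⌋}})))
    (≤-reflexive (rearrange p q))
    where
    rearrange : ∀ p q → 2 * (p * q) + 2 * (p * q) ≡ 2 * p * (2 * q)
    rearrange = solve-∀

div≤ : ∀ m n → m div n ≤ m
div≤ m zero    = z≤n
div≤ m (suc n) = m/n≤m m (suc n)

-- Time bounds for expressions and loops

Bounded : ℕ → Store → Set
Bounded L σ = ∀ a i → len (σ a i) ≤ L

-- The length of the value in units of L. It does not depend on the store: any number read from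
-- memory weighs 1, by the choice of L. The function `price` below bounds the cost of evaluation in
-- the same units.
weight : Expr → ℕ
weight (lit k)   = len k
weight (a [ e ]) = 1
weight (d ⊕ e)   = weight d + weight e
weight (d ⊖ e)   = weight d + weight e
weight (d ⊗ e)   = weight d + weight e
weight (d ⊘ e)   = weight d + weight e

price : Expr → ℕ
price (lit k)   = len k
price (a [ e ]) = price e + (weight e + 1)
price (d ⊕ e)   = price d + price e + (weight d + weight e)
price (d ⊖ e)   = price d + price e + (weight d + weight e)
price (d ⊗ e)   = price d + price e + (weight d + weight e)
price (d ⊘ e)   = price d + price e + (weight d + weight e)

module _ {L : ℕ} (0<L : 0 < L) where

  private
    k≤k*L : ∀ k → k ≤ k * L
    k≤k*L k = m≤m*n k L {{>-nonZero 0<L}}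

    merge : ∀ {m n} k l → m ≤ k * L → n ≤ l * L → m + n ≤ (k + l) * L
    merge k l m≤ n≤ =
      ≤-trans (+-mono-≤ m≤ n≤) (≤-reflexive (sym (*-distribʳ-+ L k l)))

  module _ {σ} (bσ : Bounded L σ) where

    len-eval : ∀ e → len (eval σ e) ≤ weight e * L
    len-eval (lit k)   = k≤k*L (len k)
    len-eval (a [ e ]) = ≤-trans (bσ a (eval σ e)) (≤-reflexive (sym (*-identityˡ L)))
    len-eval (d ⊕ e) = ≤-trans (len-+ (eval σ d) (eval σ e))
      (merge (weight d) (weight e) (len-eval d) (len-eval e))
    len-eval (d ⊖ e) = ≤-trans (len-mono (m∸n≤m (eval σ d) (eval σ e)))
      (≤-trans (len-eval d) (*-monoˡ-≤ L (m≤m+n (weight d) (weight e))))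
    len-eval (d ⊗ e) = ≤-trans (len-* (eval σ d) (eval σ e))
      (merge (weight d) (weight e) (len-eval d) (len-eval e))
    len-eval (d ⊘ e) = ≤-trans (len-mono (div≤ (eval σ d) (eval σ e)))
      (≤-trans (len-eval d) (*-monoˡ-≤ L (m≤m+n (weight d) (weight e))))

    cost≤ : ∀ e → cost σ e ≤ price e * L
    private
      binary≤ : ∀ d e → cost σ d + cost σ e + binaryCost (eval σ d) (eval σ e) ≤
                (price d + price e + (weight d + weight e)) * L
      binary≤ d e = merge (price d + price e) (weight d + weight e)
        (merge (price d) (price e) (cost≤ d) (cost≤ e))
        (merge (weight d) (weight e) (len-eval d) (len-eval e))
    cost≤ (lit k)   = k≤k*L (len k)
    cost≤ (a [ e ]) = merge (price e) (weight e + 1) (cost≤ e)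
      (merge (weight e) 1 (len-eval e) (len-eval (a [ e ])))
    cost≤ (d ⊕ e)   = binary≤ d e
    cost≤ (d ⊖ e)   = binary≤ d e
    cost≤ (d ⊗ e)   = binary≤ d e
    cost≤ (d ⊘ e)   = binary≤ d e

    assignCost≤ : ∀ d e →
      assignCost σ d e ≤ (price d + price e + (weight d + weight e)) * L
    assignCost≤ = binary≤

    testCost≤ : ∀ e → testCost σ e ≤ (price e + weight e) * L
    testCost≤ e = merge (price e) (weight e) (cost≤ e) (len-eval e)

-- The time is measured in units of L, which is to bound the lengths of all
-- numbers in the store.
record Run (L : ℕ) (p : Program) (σ : Store) (c : ℕ) (Q : Store → Set) : Set where
  constructor run
  field
    {time}  : ℕ
    {final} : Store
    halts   : p , σ ⇓[ time ] final
    time≤   : time ≤ c * L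
    post    : Q final

run-seq : ∀ {L p q σ r s} {Q R : Store → Set} → Run L p σ r Q →
  (∀ {σ′} → Q σ′ → Run L q σ′ s R) → Run L (p ⨾ q) σ (r + s) R
run-seq {L} {r = r} {s} (run p⇓ ≤r Qσ′) run-q with run-q Qσ′
... | run q⇓ ≤s Rσ″ = run (⇓-seq p⇓ q⇓)
  (≤-trans (+-mono-≤ ≤r ≤s) (≤-reflexive (sym (*-distribʳ-+ L r s)))) Rσ″

opaque
  assignPrice : Expr → Expr → ℕ
  assignPrice d e = price d + price e + (weight d + weight e)

  testPrice : Expr → ℕ
  testPrice e = price e + weight e

  run-assign : ∀ {L a d e σ} {Q : Store → Set} → 0 < L → Bounded L σ →
    Q (write σ a (eval σ d) (eval σ e)) → Run L (a [ d ]≔ e) σ (assignPrice d e) Q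
  run-assign {d = d} {e} 0<L bσ Qσ′ = run ⇓-assign (assignCost≤ 0<L bσ d e) Qσ′

  testTime≤ : ∀ {L} → 0 < L → ∀ {σ} → Bounded L σ → ∀ e → testCost σ e ≤ testPrice e * L
  testTime≤ 0<L bσ e = testCost≤ 0<L bσ e

-- The test computes the number of rounds that remain, so it also decides when to stop. The factor
-- `suc N` pays for the final, failing test, which is charged as a whole round.
run-while : ∀ {L e p t} N (Inv : ℕ → Store → Set) → 0 < L →
  (∀ {i σ} → Inv i σ → Bounded L σ) →
  (∀ {i σ} → Inv i σ → eval σ e ≡ N ∸ i) →
  (∀ {i σ} → i < N → Inv i σ → Run L p σ t (Inv (suc i))) →
  ∀ {σ} → Inv 0 σ →
  Run L (while e loop p) σ (suc N * (testPrice e + t)) (Inv N)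
run-while {L} {e} {p} {t} N Inv 0<L bounded test body = go N 0 (+-identityʳ N)
  where
  c = testPrice e + t

  test≤ : ∀ {i σ} → Inv i σ → testCost σ e ≤ testPrice e * L
  test≤ inv = testTime≤ 0<L (bounded inv) e

  go : ∀ m i → m + i ≡ N → ∀ {σ} → Inv i σ →
       Run L (while e loop p) σ (suc m * c) (Inv N)
  go zero    i refl {σ} inv = run (⇓-stop (trans (test inv) (n∸n≡0 i)))
    (≤-trans (test≤ inv)
      (*-monoˡ-≤ L (≤-trans (m≤m+n (testPrice e) t) (m≤m+n c 0)))) inv
  go (suc m) i refl {σ} inv with body (m<n+m i z<s) inv
  ... | run p⇓ ≤t inv′ with go m (suc i) (+-suc m i) inv′
  ... | run loop⇓ ≤r invN = run (⇓-loop nonzero p⇓ loop⇓)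
    (≤-trans (+-mono-≤ (test≤ inv) (+-mono-≤ ≤t ≤r)) (≤-reflexive regroup)) invN
    where
    nonzero : eval σ e ≢ 0
    nonzero e≡0 = m>n⇒m∸n≢0 (m<n+m i z<s) (trans (sym (test inv)) e≡0)

    regroup : testPrice e * L + (t * L + suc m * c * L) ≡ suc (suc m) * c * L
    regroup = rearrange (testPrice e) t (suc m * c) L
      where
      rearrange : ∀ p t r L → p * L + (t * L + r * L) ≡ (p + t + r) * L
      rearrange = solve-∀

weaken : ∀ {L p σ c} {Q R : Store → Set} → (∀ {σ} → Q σ → R σ) → Run L p σ c Q → Run L p σ c R
weaken Q⇒R (run p⇓ ≤c Qσ) = run p⇓ ≤c (Q⇒R Qσ)

within : ∀ {L p σ c t} {Q : Store → Set} → Run L p σ c Q → c * L ≤ t →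
  ∃[ r ] ∃[ σ′ ] (p , σ ⇓[ r ] σ′) × r ≤ t × Q σ′
within (run p⇓ ≤c Qσ) c≤t = _ , _ , p⇓ , ≤-trans ≤c c≤t , Qσ

-- Meant for sequences of assignments; the value 0 in the last clause is a default and bounds
-- nothing.
bodyPrice : Program → ℕ
bodyPrice (a [ d ]≔ e) = assignPrice d e
bodyPrice (p ⨾ q)      = bodyPrice p + bodyPrice q
bodyPrice _            = 0

-- Codes of states

div-pair : ∀ q {n r} → r < n → (q * n + r) div n ≡ q
div-pair q {suc n} {r} r<n = begin
  (q * suc n + r) / suc n             ≡⟨ +-distrib-/-∣ˡ r (n∣m*n q) ⟩
  (q * suc n) / suc n + r / suc n     ≡⟨ cong₂ _+_ (m*n/n≡m q (suc n)) (m<n⇒m/n≡0 r<n) ⟩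
  q + 0                               ≡⟨ +-identityʳ q ⟩
  q                                   ∎
  where open ≡-Reasoning

pair-injective : ∀ {n q r q′ r′} → r < n → r′ < n →
  q * n + r ≡ q′ * n + r′ → q ≡ q′ × r ≡ r′
pair-injective {n} {q} {r} {q′} {r′} r<n r′<n eq = q≡q′ ,
  +-cancelˡ-≡ (q * n) r r′ (trans eq (cong (λ p → p * n + r′) (sym q≡q′)))
  where
  q≡q′ : q ≡ q′
  q≡q′ = trans (sym (div-pair q r<n)) (trans (cong (_div n) eq) (div-pair q′ r′<n))

unpair : ∀ m {n i} → i < m * n → ∃[ q ] ∃[ r ] q < m × i ≡ q * n + toℕ {n} r
unpair m {zero}  {i} i< = contradiction (subst (i <_) (*-zeroʳ m) i<) λ ()
unpair m {suc n} {i} i< =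
  i / suc n , fromℕ< (m%n<n i (suc n)) , m<n*o⇒m/o<n {i} {m} {suc n} i< ,
  trans (m≡m%n+[m/n]*n i (suc n)) (trans (+-comm (i % suc n) _)
    (cong (λ r → i / suc n * suc n + r) (sym (Fin.toℕ-fromℕ< (m%n<n i (suc n))))))

pair< : ∀ {m n q r} → q < m → r < n → q * n + r < m * n
pair< {m} {n} {q} {r} q<m r<n = begin-strict
  q * n + r <⟨ +-monoʳ-< (q * n) r<n ⟩
  q * n + n ≡⟨ +-comm (q * n) n ⟩
  suc q * n ≤⟨ *-monoˡ-≤ n q<m ⟩
  m * n     ∎
  where open ≤-Reasoning

mask : ∀ {n} → Subset n → ℕ
mask []      = 0
mask (b ∷ S) = mask S * 2 + bit b

bit<2 : ∀ b → bit b < 2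
bit<2 true  = s≤s (s≤s z≤n)
bit<2 false = s≤s z≤n

bit-injective : ∀ {b c} → bit b ≡ bit c → b ≡ c
bit-injective {true}  {true}  _ = refl
bit-injective {false} {false} _ = refl

mask< : ∀ {n} (S : Subset n) → mask S < 2 ^ n
mask< []              = s≤s z≤n
mask< {suc n} (b ∷ S) = <-≤-trans (pair< (mask< S) (bit<2 b)) (≤-reflexive (*-comm (2 ^ n) 2))

mask-injective : ∀ {n} {S S′ : Subset n} → mask S ≡ mask S′ → S ≡ S′
mask-injective {S = []}    {[]}      _  = refl
mask-injective {S = b ∷ S} {b′ ∷ S′} eq with pair-injective (bit<2 b) (bit<2 b′) eq
... | S≡S′ , b≡b′ = cong₂ _∷_ (bit-injective b≡b′) (mask-injective S≡S′)

unmask : ∀ n {m} → m < 2 ^ n → ∃[ S ] m ≡ mask {n} S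
unmask zero    {zero} _ = [] , refl
unmask zero    {suc _} (s≤s ())
unmask (suc n) m< with unpair (2 ^ n) (<-≤-trans m< (≤-reflexive (*-comm 2 (2 ^ n))))
... | q , r , q< , m≡ with unmask n q<
unmask (suc n) m< | q , zero     , q< , m≡ | S , q≡ =
  outside ∷ S , trans m≡ (cong (λ q → q * 2 + 0) q≡)
unmask (suc n) m< | q , suc zero , q< , m≡ | S , q≡ =
  inside ∷ S , trans m≡ (cong (λ q → q * 2 + 1) q≡)

mask-⊥ : ∀ n → mask (⊥ {n}) ≡ 0
mask-⊥ zero    = refl
mask-⊥ (suc n) = cong (λ m → m * 2 + 0) (mask-⊥ n)

mask-⁅⁆ : ∀ {n} (x : Fin n) → mask ⁅ x ⁆ ≡ 2 ^ toℕ x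
mask-⁅⁆ {suc n} zero = cong (λ m → m * 2 + 1) (mask-⊥ n)
mask-⁅⁆ (suc x) =
  trans (+-identityʳ _) (trans (*-comm (mask ⁅ x ⁆) 2) (cong (2 *_) (mask-⁅⁆ x)))

mask-▸ : ∀ {n} (S : Subset n) x → x ∉ S → mask (S ▸ x) ≡ mask S + 2 ^ toℕ x
mask-▸ (true  ∷ S) zero    x∉S = contradiction Vec.here x∉S
mask-▸ (false ∷ S) zero    x∉S = cong (_+ 1) (sym (+-identityʳ (mask S * 2)))
mask-▸ (b     ∷ S) (suc x) x∉S =
  trans (cong (λ m → m * 2 + bit b) (mask-▸ S x (x∉S ∘ Vec.there)))
        (rearrange (mask S) (2 ^ toℕ x) (bit b))
  where
  rearrange : ∀ m p b → (m + p) * 2 + b ≡ m * 2 + b + 2 * p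
  rearrange = solve-∀

-- The shape fits the expression `digit`: division by the power of two strips l, and the remainder
-- modulo 2 strips h.
mask-digit : ∀ {n} (S : Subset n) x → ∃[ h ] ∃[ l ]
  l < 2 ^ toℕ x × mask S ≡ (h * 2 + bit (lookup S x)) * 2 ^ toℕ x + l
mask-digit (b ∷ S) zero = mask S , 0 , s≤s z≤n ,
  sym (trans (+-identityʳ _) (*-identityʳ _))
mask-digit (b ∷ S) (suc x) with mask-digit S x
... | h , l , l< , eq = h , l * 2 + bit b ,
  <-≤-trans (pair< l< (bit<2 b)) (≤-reflexive (*-comm (2 ^ toℕ x) 2)) ,
  trans (cong (λ m → m * 2 + bit b) eq)
        (rearrange (h * 2 + bit (lookup S x)) (2 ^ toℕ x) l (bit b))
  where
  rearrange : ∀ g p l b → (g * p + l) * 2 + b ≡ g * (2 * p) + (l * 2 + b)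
  rearrange = solve-∀

-- A number in mixed radix. Since k is the leading digit, the code is injective without a bound on
-- k.
code : ∀ {n} → ℕ → Subset n → Fin n → Fin n → ℕ
code {n} k S w v = ((k * 2 ^ n + mask S) * n + toℕ w) * n + toℕ v

code-injective : ∀ {n k k′} {S S′ : Subset n} {w w′ v v′} →
  code k S w v ≡ code k′ S′ w′ v′ → k ≡ k′ × S ≡ S′ × w ≡ w′ × v ≡ v′
code-injective {S = S} {S′} {w} {w′} {v} {v′} eq
  with pair-injective (Fin.toℕ<n v) (Fin.toℕ<n v′) eq
... | eq₁ , v≡ with pair-injective (Fin.toℕ<n w) (Fin.toℕ<n w′) eq₁
... | eq₂ , w≡ with pair-injective (mask< S) (mask< S′) eq₂
... | k≡ , S≡ = k≡ , mask-injective S≡ , Fin.toℕ-injective w≡ , Fin.toℕ-injective v≡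

-- The iteration of the main loop that handles the transitions of a state
-- determined by the vertices a and b.
stage : ∀ {n} → ℕ → Subset n → (w v a b : Fin n) → ℕ
stage {n} k S w v a b = (code k S w v * n + toℕ a) * n + toℕ b

stage< : ∀ {n k} K (S : Subset n) w v a b → k < K →
  stage k S w v a b < K * 2 ^ n * n * n * n * n
stage< K S w v a b k<K = pair< (pair< (pair< (pair< (pair< k<K (mask< S))
  (Fin.toℕ<n w)) (Fin.toℕ<n v)) (Fin.toℕ<n a)) (Fin.toℕ<n b)

unstage : ∀ {n} K {i} → i < K * 2 ^ n * n * n * n * n →
  ∃[ k ] ∃[ S ] ∃[ w ] ∃[ v ] ∃[ a ] ∃[ b ] i ≡ stage {n} k S w v a b
unstage {n} K i< with unpair (K * 2 ^ n * n * n * n) i<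
... | i₁ , b , i₁< , refl with unpair (K * 2 ^ n * n * n) i₁<
... | i₂ , a , i₂< , refl with unpair (K * 2 ^ n * n) i₂<
... | i₃ , v , i₃< , refl with unpair (K * 2 ^ n) i₃<
... | i₄ , w , i₄< , refl with unpair K i₄<
... | k , m , _ , refl with unmask n (Fin.toℕ<n m)
... | S , m≡ = k , S , w , v , a , b ,
  cong (λ m → ((((k * 2 ^ n + m) * n + toℕ w) * n + toℕ v) * n + toℕ a) * n + toℕ b) m≡

-- Reading the input

nth-here : ∀ {n} (V : Subset n) ys i →
  nth (List.map bit (toList V ++ ys)) (toℕ i) ≡ bit (lookup V i)
nth-here (b ∷ V) ys zero    = refl
nth-here (b ∷ V) ys (suc i) = nth-here V ys i

nth-there : ∀ {n} (V : Subset n) ys j →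
  nth (List.map bit (toList V ++ ys)) (n + j) ≡ nth (List.map bit ys) j
nth-there []      ys j = refl
nth-there (b ∷ V) ys j = nth-there V ys j

nth-matrix : ∀ {m n} (A : Vec (Subset n) m) u v →
  nth (List.map bit (toList (Vec.concat A))) (toℕ u * n + toℕ v) ≡ bit (lookup (lookup A u) v)
nth-matrix {n = n} (R ∷ A) zero v = trans
  (cong (λ l → nth (List.map bit l) (toℕ v)) (Vec.toList-++ R (Vec.concat A)))
  (nth-here R _ v)
nth-matrix {n = n} (R ∷ A) (suc u) v = trans
  (cong₂ (λ l j → nth (List.map bit l) j) (Vec.toList-++ R (Vec.concat A))
         (+-assoc n (toℕ u * n) (toℕ v)))
  (trans (nth-there R _ (toℕ u * n + toℕ v)) (nth-matrix A u v))

-- The `suc` pays for the default 0 beyond the end of the list, whose length is 1.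
len-nth≤ : ∀ xs i → len (nth xs i) ≤ suc (sum (List.map len xs))
len-nth≤ []       i       = ≤-refl
len-nth≤ (x ∷ xs) zero    = m≤n⇒m≤1+n (m≤m+n (len x) _)
len-nth≤ (x ∷ xs) (suc i) = ≤-trans (len-nth≤ xs i) (s≤s (m≤n+m _ (len x)))

length≤size : ∀ xs → List.length xs ≤ sum (List.map len xs)
length≤size []       = z≤n
length≤size (x ∷ xs) = s≤s (≤-trans (length≤size xs) (m≤n+m _ ⌊log₂ x ⌋))

-- The program

infixl 7 _mod_

_mod_ : Expr → Expr → Expr
e mod d = e ⊖ e ⊘ d ⊗ d

-- Nonzero means true, so `_⊗_` is conjunction, `_⊕_` is disjunction and `isZero` is negation.
-- `positive` reduces a truth value to a single bit.
positive isZero : Expr → Expr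
positive e = lit 1 ⊖ (lit 1 ⊖ e)
isZero e   = lit 1 ⊖ e

-- Besides the input (0) and the answer (1), the program uses the arrays
--   2: the powers of two,
--   3: the table of the states reached so far, indexed by their codes,
--   4: nonzero at the mask of S if S misses a terminal,
--   5, 6, 7: the loop counters, in cell 0.

var : Name → Expr
var a = a [ lit 0 ]

vertices sign magnitude : Expr
vertices  = 0 [ lit 0 ]
sign      = 0 [ lit 1 ]
magnitude = 0 [ lit 2 ]

isTerminal : Expr → Expr
isTerminal a = 0 [ lit 3 ⊕ a ]

hasArc : Expr → Expr → Expr
hasArc w a = 0 [ lit 3 ⊕ (vertices ⊕ (w ⊗ vertices ⊕ a)) ]

power : Expr → Expr
power x = 2 [ x ]

digit : Expr → Expr → Expr
digit s x = s ⊘ power x mod lit 2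

codeᴱ : Expr → Expr → Expr → Expr → Expr
codeᴱ k s w v = ((k ⊗ power vertices ⊕ s) ⊗ vertices ⊕ w) ⊗ vertices ⊕ v

-- A disjunction in place: a cell once set is never cleared, and it stays a bit, however often it is
-- marked.
mark : Name → Expr → Expr → Program
mark a d c = a [ d ]≔ positive (a [ d ] ⊕ c)

increment : Name → Program
increment a = a [ lit 0 ]≔ lit 1 ⊕ var a

test₁ test₂ test₃ : Expr
test₁ = vertices ⊖ var 5
test₂ = power vertices ⊗ vertices ⊖ var 6
test₃ = (lit 1 ⊕ vertices ⊗ vertices) ⊗ power vertices
          ⊗ vertices ⊗ vertices ⊗ vertices ⊗ vertices ⊖ var 7

-- The code of a start state: the leading digit k is 0, and the mask of the singleton of vertex i is
-- the power of two with exponent i. That power is already in the table when the first loop comes to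
-- i.
singletonᴱ : Expr
singletonᴱ = (power (var 5) ⊗ vertices ⊕ var 5) ⊗ vertices ⊕ var 5

body₁ : Program
body₁ =
  mark 3 singletonᴱ (lit 1) ⨾
  2 [ lit 1 ⊕ var 5 ]≔ lit 2 ⊗ power (var 5) ⨾
  increment 5

opaque
  uncovered : Expr
  uncovered = isTerminal (var 6 mod vertices)
                ⊗ isZero (digit (var 6 ⊘ vertices) (var 6 mod vertices))

body₂ : Program
body₂ = mark 4 (var 6 ⊘ vertices) uncovered ⨾ increment 6

bᴱ aᴱ srcᴱ vᴱ wᴱ sᴱ kᴱ : Expr
bᴱ   = var 7 mod vertices
aᴱ   = var 7 ⊘ vertices mod vertices
srcᴱ = var 7 ⊘ vertices ⊘ vertices
vᴱ   = srcᴱ mod vertices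
wᴱ   = srcᴱ ⊘ vertices mod vertices
sᴱ   = srcᴱ ⊘ vertices ⊘ vertices mod power vertices
kᴱ   = srcᴱ ⊘ vertices ⊘ vertices ⊘ power vertices

opaque
  extendable closable acceptable : Expr
  extendable = 3 [ srcᴱ ] ⊗ (hasArc wᴱ aᴱ ⊗ isZero (digit sᴱ aᴱ))
  closable   = 3 [ srcᴱ ] ⊗ (hasArc wᴱ vᴱ ⊗ (digit sᴱ aᴱ ⊗ digit sᴱ bᴱ))
  acceptable = 3 [ srcᴱ ] ⊗ (isZero ((wᴱ ⊖ vᴱ) ⊕ (vᴱ ⊖ wᴱ)) ⊗
                 (isZero (4 [ sᴱ ]) ⊗ (isZero (kᴱ ⊖ magnitude) ⊗ isZero sign)))

  extended closed : Expr
  extended = codeᴱ (lit 1 ⊕ kᴱ) (sᴱ ⊕ power aᴱ) aᴱ vᴱ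
  closed   = codeᴱ (lit 1 ⊕ kᴱ) sᴱ aᴱ bᴱ

-- A transition that does not apply marks some cell, perhaps that of an
-- unrelated state, with zero, which leaves unchanged whether it is zero.
body₃ : Program
body₃ = mark 3 extended extendable ⨾ mark 3 closed closable ⨾
        mark 1 (lit 0) acceptable ⨾ increment 7

-- Without vertices no loop is ever entered, and the budget alone decides.
prepare steiner : Program
prepare = 2 [ lit 0 ]≔ lit 1 ⨾ 1 [ lit 0 ]≔ isZero vertices ⊗ isZero sign
steiner =
  prepare ⨾ while test₁ loop body₁ ⨾ while test₂ loop body₂ ⨾ while test₃ loop body₃

-- Arithmetic of truth values and marks

≢0-resp : ∀ {m n} → m ≡ n → n ≢ 0 → m ≢ 0
≢0-resp refl n≢0 = n≢0

*≢0⁻ : ∀ {m n} → m * n ≢ 0 → m ≢ 0 × n ≢ 0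
*≢0⁻ {m} mn≢0 = (λ { refl → mn≢0 refl }) , λ { refl → mn≢0 (*-zeroʳ m) }

*≢0⁺ : ∀ {m n} → m ≢ 0 → n ≢ 0 → m * n ≢ 0
*≢0⁺ {zero}  m≢0 _ = ⊥-elim (m≢0 refl)
*≢0⁺ {suc m} {zero}  _ n≢0 = ⊥-elim (n≢0 refl)
*≢0⁺ {suc m} {suc n} _ _ ()

1∸≢0⁻ : ∀ {m} → 1 ∸ m ≢ 0 → m ≡ 0
1∸≢0⁻ {zero}  _  = refl
1∸≢0⁻ {suc m} ≢0 = ⊥-elim (≢0 (0∸n≡0 m))

1∸≢0⁺ : ∀ {m} → m ≡ 0 → 1 ∸ m ≢ 0
1∸≢0⁺ refl ()

sgn : ℕ → ℕ
sgn m = 1 ∸ (1 ∸ m)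

sgn≤1 : ∀ m → sgn m ≤ 1
sgn≤1 m = m∸n≤m 1 (1 ∸ m)

sgn≢0⁺ : ∀ {m} → m ≢ 0 → sgn m ≢ 0
sgn≢0⁺ {zero}  m≢0 = m≢0
sgn≢0⁺ {suc m} _ eq with trans (cong (1 ∸_) (sym (0∸n≡0 m))) eq
... | ()

sgn≢0⁻ : ∀ {m} → sgn m ≢ 0 → m ≢ 0
sgn≢0⁻ sgn≢0 refl = sgn≢0 refl

+≢0⁻ : ∀ {m n} → m + n ≢ 0 → m ≢ 0 ⊎ n ≢ 0
+≢0⁻ {zero}  n≢0 = inj₂ n≢0
+≢0⁻ {suc m} _   = inj₁ λ ()

+≢0ˡ : ∀ {m} n → m ≢ 0 → m + n ≢ 0
+≢0ˡ {m} n m≢0 = m≢0 ∘ m+n≡0⇒m≡0 m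

+≢0ʳ : ∀ m {n} → n ≢ 0 → m + n ≢ 0
+≢0ʳ m n≢0 = n≢0 ∘ m+n≡0⇒n≡0 m

bit≢0⁺ : ∀ {n} {S : Subset n} {x} → x ∈ S → bit (lookup S x) ≢ 0
bit≢0⁺ x∈S eq with trans (sym (cong bit (Vec.[]=⇒lookup x∈S))) eq
... | ()

bit≢0⁻ : ∀ {n} {S : Subset n} {x} → bit (lookup S x) ≢ 0 → x ∈ S
bit≢0⁻ {S = S} {x} ≢0 = Vec.lookup⇒[]= x S (is-true (lookup S x) ≢0)
  where
  is-true : ∀ b → bit b ≢ 0 → b ≡ true
  is-true true  _  = refl
  is-true false ≢0 = ⊥-elim (≢0 refl)

bit≡0⁺ : ∀ {n} {S : Subset n} {x} → x ∉ S → bit (lookup S x) ≡ 0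
bit≡0⁺ {S = S} {x} x∉S with lookup S x in eq
... | true  = contradiction (Vec.lookup⇒[]= x S eq) x∉S
... | false = refl

bit≡0⁻ : ∀ {n} {S : Subset n} {x} → bit (lookup S x) ≡ 0 → x ∉ S
bit≡0⁻ ≡0 x∈S = bit≢0⁺ x∈S ≡0

marked : (ℕ → ℕ) → ℕ → ℕ → ℕ → ℕ
marked f t c j = if t ≡ᵇ j then sgn (f t + c) else f j

≡ᵇ-true : ∀ {m n} → (m ≡ᵇ n) ≡ true → m ≡ n
≡ᵇ-true {m} {n} eq = ≡ᵇ⇒≡ m n (subst T (sym eq) _)

≡ᵇ-refl : ∀ n → (n ≡ᵇ n) ≡ true
≡ᵇ-refl zero    = refl
≡ᵇ-refl (suc n) = ≡ᵇ-refl n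

marked-grow : ∀ f t c {j} → f j ≢ 0 → marked f t c j ≢ 0
marked-grow f t c {j} fj≢0 with t ≡ᵇ j in eq
... | false = fj≢0
... | true  with refl ← ≡ᵇ-true {t} {j} eq = sgn≢0⁺ (+≢0ˡ c fj≢0)

marked-hit : ∀ f t {c} → c ≢ 0 → marked f t c t ≢ 0
marked-hit f t c≢0 rewrite ≡ᵇ-refl t = sgn≢0⁺ (+≢0ʳ (f t) c≢0)

marked⁻ : ∀ f t c {j} → marked f t c j ≢ 0 → f j ≢ 0 ⊎ (j ≡ t × c ≢ 0)
marked⁻ f t c {j} ≢0 with t ≡ᵇ j in eq
... | false = inj₁ ≢0
... | true  with refl ← ≡ᵇ-true {t} {j} eq with +≢0⁻ (sgn≢0⁻ ≢0)
... | inj₁ ft≢0 = inj₁ ft≢0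
... | inj₂ c≢0  = inj₂ (refl , c≢0)

updated-same : ∀ (f : ℕ → ℕ) t v → (if t ≡ᵇ t then v else f t) ≡ v
updated-same f t v rewrite ≡ᵇ-refl t = refl

updated-other : ∀ (f : ℕ → ℕ) {t j} v → j ≢ t → (if t ≡ᵇ j then v else f j) ≡ f j
updated-other f {t} {j} v j≢t with t ≡ᵇ j in eq
... | false = refl
... | true  = contradiction (sym (≡ᵇ-true {t} {j} eq)) j≢t

write-bounded : ∀ {L σ} a i v → Bounded L σ → len v ≤ L → Bounded L (write σ a i v)
write-bounded a i v bσ v≤ b j with a ≡ᵇ b
... | false = bσ b j
... | true with i ≡ᵇ j
...   | false = bσ b j
...   | true  = v≤

eval-⊘ : ∀ σ e d q {m r} → eval σ e ≡ q * m + r → eval σ d ≡ m → r < m →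
  eval σ (e ⊘ d) ≡ q
eval-⊘ σ e d q e≡ d≡ r<m = trans (cong₂ _div_ e≡ d≡) (div-pair q r<m)

eval-mod : ∀ σ e d q {m r} → eval σ e ≡ q * m + r → eval σ d ≡ m → r < m →
  eval σ (e mod d) ≡ r
eval-mod σ e d q {m} {r} e≡ d≡ r<m =
  trans (cong₂ _∸_ e≡ (cong₂ _*_ (eval-⊘ σ e d q e≡ d≡ r<m) d≡)) (m+n∸m≡n (q * m) r)

signOf : ℤ → ℕ
signOf (+ k)    = 0
signOf -[1+ k ] = 1

encodeℤ-++ : ∀ b xs → encodeℤ b ++ xs ≡ signOf b ∷ ℤ.∣ b ∣ ∷ xs
encodeℤ-++ (+ k)    xs = refl
encodeℤ-++ -[1+ k ] xs = refl

+≤⇒ : ∀ {k b} → + k ℤ.≤ b → k ∸ ℤ.∣ b ∣ ≡ 0 × signOf b ≡ 0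
+≤⇒ (ℤ.+≤+ k≤b) = m≤n⇒m∸n≡0 k≤b , refl

⇒+≤ : ∀ {k} b → k ∸ ℤ.∣ b ∣ ≡ 0 → signOf b ≡ 0 → + k ℤ.≤ b
⇒+≤ (+ b) k∸b≡0 _ = ℤ.+≤+ (m∸n≡0⇒m≤n k∸b≡0)

∸+∸≡0⇒≡ : ∀ {n} {w v : Fin n} → (toℕ w ∸ toℕ v) + (toℕ v ∸ toℕ w) ≡ 0 → w ≡ v
∸+∸≡0⇒≡ {w = w} {v} eq = Fin.toℕ-injective (≤-antisym
  (m∸n≡0⇒m≤n (m+n≡0⇒m≡0 (toℕ w ∸ toℕ v) eq))
  (m∸n≡0⇒m≤n (m+n≡0⇒n≡0 (toℕ w ∸ toℕ v) eq)))

stage-injective : ∀ {n k k′} {S S′ : Subset n} {w w′ v v′ a a′ b b′} →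
  stage k S w v a b ≡ stage k′ S′ w′ v′ a′ b′ →
  k ≡ k′ × S ≡ S′ × w ≡ w′ × v ≡ v′ × a ≡ a′ × b ≡ b′
stage-injective {k = k} {k′} {S} {S′} {w} {w′} {v} {v′} {a} {a′} {b} {b′} eq
  with pair-injective (Fin.toℕ<n b) (Fin.toℕ<n b′) eq
... | eq₁ , b≡ with pair-injective (Fin.toℕ<n a) (Fin.toℕ<n a′) eq₁
... | eq₂ , a≡ with code-injective {k = k} {k′} {S} {S′} {w} {w′} {v} {v′} eq₂
... | k≡ , S≡ , w≡ , v≡ =
  k≡ , S≡ , w≡ , v≡ , Fin.toℕ-injective a≡ , Fin.toℕ-injective b≡

stage≥ : ∀ {n} k (S : Subset n) w v a b → k * 2 ^ n * n * n * n * n ≤ stage k S w v a b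
stage≥ {n} k S w v a b =
  up (p * n * n * n) (code k S w v * n + toℕ a) (toℕ b)
    (up (p * n * n) (code k S w v) (toℕ a)
      (up (p * n) ((p + mask S) * n + toℕ w) (toℕ v)
        (up p (p + mask S) (toℕ w) (m≤m+n p (mask S)))))
  where
  p = k * 2 ^ n

  up : ∀ p q r → p ≤ q → p * n ≤ q * n + r
  up p q r p≤q = ≤-trans (*-monoˡ-≤ n p≤q) (m≤m+n (q * n) r)

module _ (I : SteinerInstance) where

  private
    n = order I
    A = arcs I
    Term = terminals I

  iterations : ℕ
  iterations = suc (n * n) * 2 ^ n * n * n * n * n

  record Reads (input : ℕ → ℕ) : Set where
    field
      vertices≡  : input 0 ≡ n
      sign≡      : input 1 ≡ signOf (budget I)
      magnitude≡ : input 2 ≡ ℤ.∣ budget I ∣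
      terminal≡  : ∀ a → input (3 + toℕ a) ≡ bit (lookup Term a)
      arc≡       : ∀ w a → input (3 + (n + (toℕ w * n + toℕ a))) ≡ bit (lookup (lookup A w) a)

  reads-initial : Reads (initial (encodeSteiner I) 0)
  reads-initial = subst (λ xs → Reads (nth (n ∷ xs))) (sym (encodeℤ-++ (budget I) _)) record
    { vertices≡  = refl
    ; sign≡      = refl
    ; magnitude≡ = refl
    ; terminal≡  = nth-here Term _
    ; arc≡       = λ w a → trans (nth-there Term _ _) (nth-matrix A w a)
    }

  Powers : ℕ → (ℕ → ℕ) → Set
  Powers m pw = ∀ {x} → x ≤ m → pw x ≡ 2 ^ x

  Sound : (ℕ → ℕ) → Set
  Sound R = ∀ {k S w v} → R (code k S w v) ≢ 0 → Der A k S w v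

  -- Injectivity of the code excludes that a justified mark also stands for some other, underivable
  -- state.
  marked-sound : ∀ {R t c} → Sound R →
    (c ≢ 0 → ∃[ k ] ∃[ S ] ∃[ w ] ∃[ v ] t ≡ code k S w v × Der A k S w v) →
    Sound (marked R t c)
  marked-sound {R} {t} {c} sound new {k} {S} {w} {v} ≢0 with marked⁻ R t c ≢0
  ... | inj₁ Rj≢0        = sound Rj≢0
  ... | inj₂ (j≡t , c≢0) with new c≢0
  ... | k′ , S′ , w′ , v′ , t≡ , d
    with code-injective {k = k} {k′} {S} {S′} {w} {w′} {v} {v′} (trans j≡t t≡)
  ... | refl , refl , refl , refl = d

  -- The premises speak of derivable states, not of marked ones. This is the right form because a
  -- derivable state is already marked when its own stages begin, as `reached` shows.
  record Complete (m : ℕ) (R : ℕ → ℕ) (ans : ℕ) : Set where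
    field
      started  : ∀ (r : Fin n) → R (code 0 ⁅ r ⁆ r r) ≢ 0
      extends  : ∀ {k S w v a b} → stage k S w v a b < m → Der A k S w v →
                 a ∉ S → Arc A w a → R (code (suc k) (S ▸ a) a v) ≢ 0
      closes   : ∀ {k S w v a b} → stage k S w v a b < m → Der A k S w v →
                 Arc A w v → a ∈ S → b ∈ S → R (code (suc k) S a b) ≢ 0
      accepted : ∀ {k S w a b} → stage k S w w a b < m → Der A k S w w →
                 Term ⊆ S → + k ℤ.≤ budget I → ans ≢ 0

  -- The number of arcs is the most significant digit of a stage, so the
  -- stages leading to a state precede those handling it.
  reached : ∀ {m R ans} → Complete m R ans → ∀ {k S w v} a b → m ≡ stage k S w v a b →
    Der A k S w v → R (code k S w v) ≢ 0
  reached c _ _ _ (start r) = Complete.started c r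
  reached c {k = suc k} a b refl (extend {S = S} {w} {v} {x} d x∉S wx) =
    Complete.extends c {b = x}
      (<-≤-trans (stage< (suc k) S w v x x ≤-refl) (stage≥ (suc k) (S ▸ x) x v a b)) d x∉S wx
  reached c {k = suc k} a b refl (close {S = S} {w} {v} {p} {q} d wv p∈ q∈) =
    Complete.closes c
      (<-≤-trans (stage< (suc k) S w v p q ≤-refl) (stage≥ (suc k) S p q a b)) d wv p∈ q∈

  module Decode (σ : Store) (reads : Reads (σ 0)) (powers : Powers n (σ 2))
                {k : ℕ} {S : Subset n} {w v a b : Fin n}
                (stage≡ : σ 7 0 ≡ stage k S w v a b) where
    open Reads reads

    b≡ : eval σ bᴱ ≡ toℕ b
    b≡ = eval-mod σ (var 7) vertices (code k S w v * n + toℕ a) stage≡ vertices≡ (Fin.toℕ<n b)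

    private
      i₁ : eval σ (var 7 ⊘ vertices) ≡ code k S w v * n + toℕ a
      i₁ = eval-⊘ σ (var 7) vertices (code k S w v * n + toℕ a) stage≡ vertices≡ (Fin.toℕ<n b)

    a≡ : eval σ aᴱ ≡ toℕ a
    a≡ = eval-mod σ (var 7 ⊘ vertices) vertices (code k S w v) i₁ vertices≡ (Fin.toℕ<n a)

    src≡ : eval σ srcᴱ ≡ code k S w v
    src≡ = eval-⊘ σ (var 7 ⊘ vertices) vertices (code k S w v) i₁ vertices≡ (Fin.toℕ<n a)

    v≡ : eval σ vᴱ ≡ toℕ v
    v≡ = eval-mod σ srcᴱ vertices
      ((k * 2 ^ n + mask S) * n + toℕ w) src≡ vertices≡ (Fin.toℕ<n v)

    private
      i₂ : eval σ (srcᴱ ⊘ vertices) ≡ (k * 2 ^ n + mask S) * n + toℕ w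
      i₂ = eval-⊘ σ srcᴱ vertices
        ((k * 2 ^ n + mask S) * n + toℕ w) src≡ vertices≡ (Fin.toℕ<n v)

    w≡ : eval σ wᴱ ≡ toℕ w
    w≡ = eval-mod σ (srcᴱ ⊘ vertices) vertices (k * 2 ^ n + mask S) i₂ vertices≡ (Fin.toℕ<n w)

    private
      i₃ : eval σ (srcᴱ ⊘ vertices ⊘ vertices) ≡ k * 2 ^ n + mask S
      i₃ = eval-⊘ σ (srcᴱ ⊘ vertices) vertices (k * 2 ^ n + mask S) i₂ vertices≡ (Fin.toℕ<n w)

      2^n≡ : eval σ (power vertices) ≡ 2 ^ n
      2^n≡ = trans (cong (σ 2) vertices≡) (powers ≤-refl)

    s≡ : eval σ sᴱ ≡ mask S
    s≡ = eval-mod σ (srcᴱ ⊘ vertices ⊘ vertices) (power vertices) k i₃ 2^n≡ (mask< S)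

    k≡ : eval σ kᴱ ≡ k
    k≡ = eval-⊘ σ (srcᴱ ⊘ vertices ⊘ vertices) (power vertices) k i₃ 2^n≡ (mask< S)

    power≡ : ∀ e (x : Fin n) → eval σ e ≡ toℕ x → eval σ (power e) ≡ 2 ^ toℕ x
    power≡ e x e≡ = trans (cong (σ 2) e≡) (powers (<⇒≤ (Fin.toℕ<n x)))

    code≡ : ∀ {k s w v} kₑ sₑ wₑ vₑ → eval σ kₑ ≡ k → eval σ sₑ ≡ s → eval σ wₑ ≡ w →
      eval σ vₑ ≡ v → eval σ (codeᴱ kₑ sₑ wₑ vₑ) ≡ ((k * 2 ^ n + s) * n + w) * n + v
    code≡ kₑ sₑ wₑ vₑ refl refl refl refl rewrite 2^n≡ | vertices≡ = refl

  digit≡ : ∀ σ → Powers n (σ 2) → ∀ s e (S : Subset n) x → eval σ s ≡ mask S →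
    eval σ e ≡ toℕ x → eval σ (digit s e) ≡ bit (lookup S x)
  digit≡ σ powers s e S x s≡ e≡ with mask-digit S x
  ... | h , l , l< , eq = eval-mod σ (s ⊘ power e) (lit 2) h
    (eval-⊘ σ s (power e) (h * 2 + bit (lookup S x)) (trans s≡ eq)
      (trans (cong (σ 2) e≡) (powers (<⇒≤ (Fin.toℕ<n x)))) l<)
    refl (bit<2 (lookup S x))

  arcᴱ≡ : ∀ σ → Reads (σ 0) → ∀ d e (w a : Fin n) → eval σ d ≡ toℕ w → eval σ e ≡ toℕ a →
    eval σ (hasArc d e) ≡ bit (lookup (lookup A w) a)
  arcᴱ≡ σ reads d e w a d≡ e≡ = trans
    (cong (λ j → σ 0 (3 + j)) (cong₂ _+_ vertices≡ (cong₂ _+_ (cong₂ _*_ d≡ vertices≡) e≡)))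
    (arc≡ w a)
    where open Reads reads

-- Loop invariants

module _ (I : SteinerInstance) where

  private
    n = order I
    A = arcs I
    Term = terminals I

  module Transition (σ : Store) (reads : Reads I (σ 0)) (powers : Powers I n (σ 2))
                    {k : ℕ} {S : Subset n} {w v a b : Fin n}
                    (stage≡ : σ 7 0 ≡ stage k S w v a b) where
    open Decode I σ reads powers {k} {S} {w} {v} {a} {b} stage≡
    open Reads reads

    private
      stored : eval σ (3 [ srcᴱ ]) ≡ σ 3 (code k S w v)
      stored = cong (σ 3) src≡

      wa≡ : eval σ (hasArc wᴱ aᴱ) ≡ bit (lookup (lookup A w) a)
      wa≡ = arcᴱ≡ I σ reads wᴱ aᴱ w a w≡ a≡

      wv≡ : eval σ (hasArc wᴱ vᴱ) ≡ bit (lookup (lookup A w) v)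
      wv≡ = arcᴱ≡ I σ reads wᴱ vᴱ w v w≡ v≡

      a∈S≡ : eval σ (digit sᴱ aᴱ) ≡ bit (lookup S a)
      a∈S≡ = digit≡ I σ powers sᴱ aᴱ S a s≡ a≡

      b∈S≡ : eval σ (digit sᴱ bᴱ) ≡ bit (lookup S b)
      b∈S≡ = digit≡ I σ powers sᴱ bᴱ S b s≡ b≡

      difference≡ : eval σ ((wᴱ ⊖ vᴱ) ⊕ (vᴱ ⊖ wᴱ)) ≡ (toℕ w ∸ toℕ v) + (toℕ v ∸ toℕ w)
      difference≡ = cong₂ _+_ (cong₂ _∸_ w≡ v≡) (cong₂ _∸_ v≡ w≡)

      excess≡ : eval σ (kᴱ ⊖ magnitude) ≡ k ∸ ℤ.∣ budget I ∣
      excess≡ = cong₂ _∸_ k≡ magnitude≡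

    opaque
      unfolding extendable

      extendable⁻ : eval σ extendable ≢ 0 → σ 3 (code k S w v) ≢ 0 × Arc A w a × a ∉ S
      extendable⁻ ≢0 with *≢0⁻ ≢0
      ... | src≢0 , ≢0′ with *≢0⁻ ≢0′
      ... | wa≢0 , a∉ = ≢0-resp (sym stored) src≢0 , bit≢0⁻ (≢0-resp (sym wa≡) wa≢0) ,
        bit≡0⁻ (trans (sym a∈S≡) (1∸≢0⁻ a∉))

      extendable⁺ : σ 3 (code k S w v) ≢ 0 → Arc A w a → a ∉ S → eval σ extendable ≢ 0
      extendable⁺ src≢0 wa a∉S = *≢0⁺ (≢0-resp stored src≢0)
        (*≢0⁺ (≢0-resp wa≡ (bit≢0⁺ wa)) (1∸≢0⁺ (trans a∈S≡ (bit≡0⁺ a∉S))))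

      extended≡ : a ∉ S → eval σ extended ≡ code (suc k) (S ▸ a) a v
      extended≡ a∉S = code≡ (lit 1 ⊕ kᴱ) (sᴱ ⊕ power aᴱ) aᴱ vᴱ (cong suc k≡)
        (trans (cong₂ _+_ s≡ (power≡ aᴱ a a≡)) (sym (mask-▸ S a a∉S))) a≡ v≡

      closable⁻ : eval σ closable ≢ 0 →
        σ 3 (code k S w v) ≢ 0 × Arc A w v × a ∈ S × b ∈ S
      closable⁻ ≢0 with *≢0⁻ ≢0
      ... | src≢0 , ≢0′ with *≢0⁻ ≢0′
      ... | wv≢0 , ≢0″ with *≢0⁻ ≢0″
      ... | a≢0 , b≢0 = ≢0-resp (sym stored) src≢0 , bit≢0⁻ (≢0-resp (sym wv≡) wv≢0) ,
        bit≢0⁻ (≢0-resp (sym a∈S≡) a≢0) , bit≢0⁻ (≢0-resp (sym b∈S≡) b≢0)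

      closable⁺ : σ 3 (code k S w v) ≢ 0 → Arc A w v → a ∈ S → b ∈ S → eval σ closable ≢ 0
      closable⁺ src≢0 wv a∈S b∈S = *≢0⁺ (≢0-resp stored src≢0)
        (*≢0⁺ (≢0-resp wv≡ (bit≢0⁺ wv))
          (*≢0⁺ (≢0-resp a∈S≡ (bit≢0⁺ a∈S)) (≢0-resp b∈S≡ (bit≢0⁺ b∈S))))

      closed≡ : eval σ closed ≡ code (suc k) S a b
      closed≡ = code≡ (lit 1 ⊕ kᴱ) sᴱ aᴱ bᴱ (cong suc k≡) s≡ a≡ b≡

      acceptable⁻ : eval σ acceptable ≢ 0 →
        σ 3 (code k S w v) ≢ 0 × w ≡ v × σ 4 (mask S) ≡ 0 × + k ℤ.≤ budget I
      acceptable⁻ ≢0 with *≢0⁻ ≢0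
      ... | src≢0 , ≢0₁ with *≢0⁻ ≢0₁
      ... | wv≢0 , ≢0₂ with *≢0⁻ ≢0₂
      ... | cov≢0 , ≢0₃ with *≢0⁻ ≢0₃
      ... | k≢0 , sign≢0 = ≢0-resp (sym stored) src≢0 ,
        ∸+∸≡0⇒≡ (trans (sym difference≡) (1∸≢0⁻ wv≢0)) ,
        trans (cong (σ 4) (sym s≡)) (1∸≢0⁻ cov≢0) ,
        ⇒+≤ (budget I) (trans (sym excess≡) (1∸≢0⁻ k≢0)) (trans (sym sign≡) (1∸≢0⁻ sign≢0))

      acceptable⁺ : σ 3 (code k S w v) ≢ 0 → w ≡ v → σ 4 (mask S) ≡ 0 →
        + k ℤ.≤ budget I → eval σ acceptable ≢ 0
      acceptable⁺ src≢0 refl cov k≤b = *≢0⁺ (≢0-resp stored src≢0)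
        (*≢0⁺ (1∸≢0⁺ (trans difference≡ (cong₂ _+_ (n∸n≡0 (toℕ w)) (n∸n≡0 (toℕ w)))))
          (*≢0⁺ (1∸≢0⁺ (trans (cong (σ 4) s≡) cov))
            (*≢0⁺ (1∸≢0⁺ (trans excess≡ (proj₁ (+≤⇒ k≤b))))
                  (1∸≢0⁺ (trans sign≡ (proj₂ (+≤⇒ k≤b)))))))

-- The bounds on L cover everything that is ever stored: the input, single bits, the powers of two
-- up to exponent n, and the three counters up to their final values. Computed addresses are not
-- stored; their lengths are charged through `weight`.
module Loops (I : SteinerInstance) (L : ℕ) (0<L : 0 < L)
  (input≤ : ∀ i → len (nth (encodeSteiner I) i) ≤ L)
  (order<L : order I < L)
  (len₁ : len (order I) ≤ L)
  (len₂ : len (2 ^ order I * order I) ≤ L)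
  (len₃ : len (iterations I) ≤ L) where

  private
    n = order I
    A = arcs I
    Term = terminals I

  record Base (σ : Store) : Set where
    field
      bounded : Bounded L σ
      reads   : Reads I (σ 0)
      sound   : Sound I (σ 3)
      binary  : σ 1 0 ≤ 1
      affirms : σ 1 0 ≢ 0 → HasSolution I
      trivial : n ≡ 0 → HasSolution I → σ 1 0 ≢ 0

  record Inv₁ (i : ℕ) (σ : Store) : Set where
    field
      isBase  : Base σ
      powers  : Powers I i (σ 2)
      started : ∀ (r : Fin n) → toℕ r < i → σ 3 (code 0 ⁅ r ⁆ r r) ≢ 0
      counter : σ 5 0 ≡ i
      zero₄   : ∀ j → σ 4 j ≡ 0
      zero₆   : σ 6 0 ≡ 0
      zero₇   : σ 7 0 ≡ 0

  record Inv₂ (i : ℕ) (σ : Store) : Set where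
    field
      isBase   : Base σ
      powers   : Powers I n (σ 2)
      started  : ∀ (r : Fin n) → σ 3 (code 0 ⁅ r ⁆ r r) ≢ 0
      counter  : σ 6 0 ≡ i
      flagged  : ∀ {S : Subset n} {t} → mask S * n + toℕ t < i →
                 t ∈ Term → t ∉ S → σ 4 (mask S) ≢ 0
      flagged⁻ : ∀ {S : Subset n} → σ 4 (mask S) ≢ 0 → ¬ (Term ⊆ S)
      zero₇    : σ 7 0 ≡ 0

  record Inv₃ (i : ℕ) (σ : Store) : Set where
    field
      isBase   : Base σ
      powers   : Powers I n (σ 2)
      counter  : σ 7 0 ≡ i
      covered  : ∀ {S : Subset n} → σ 4 (mask S) ≡ 0 → Term ⊆ S
      covered⁻ : ∀ {S : Subset n} → Term ⊆ S → σ 4 (mask S) ≡ 0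
      complete : Complete I i (σ 3) (σ 1 0)

  bit-fits : ∀ {v : ℕ} → v ≤ 1 → len v ≤ L
  bit-fits v≤1 = ≤-trans (len-mono v≤1) 0<L

  mark-fits : ∀ m → len (sgn m) ≤ L
  mark-fits m = bit-fits (sgn≤1 m)

  power-fits : ∀ {x} → x ≤ n → len (2 ^ x) ≤ L
  power-fits {x} x≤n =
    ≤-trans (≤-reflexive (cong suc (⌊log₂[2^n]⌋≡n x))) (≤-<-trans x≤n order<L)

  -- Each condition is evaluated in the store left by the marks before it. Input, powers and counter
  -- are unchanged until the end, so the stage is decoded alike in all three stores; and since marks
  -- are never cleared, the source state stays visible.
  step₃ : ∀ {i σ} → i < iterations I → Inv₃ i σ → Run L body₃ σ (bodyPrice body₃) (Inv₃ (suc i))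
  step₃ {i} {σ} i<N inv with unstage {n} (suc (n * n)) i<N
  ... | k , S , w , v , a , b , i≡ =
    run-seq (run-assign {Q = _≡ σ₁} 0<L bounded refl) λ { refl →
    run-seq (run-assign {Q = _≡ σ₂} 0<L bounded₁ refl) λ { refl →
    run-seq (run-assign {Q = _≡ σ₃} 0<L bounded₂ refl) λ { refl →
    run-assign 0<L bounded₃ inv′ }}}
    where
    open Inv₃ inv
    open Base isBase

    σ₁ = write σ 3 (eval σ extended) (eval σ (positive (3 [ extended ] ⊕ extendable)))
    σ₂ = write σ₁ 3 (eval σ₁ closed) (eval σ₁ (positive (3 [ closed ] ⊕ closable)))
    σ₃ = write σ₂ 1 0 (eval σ₂ (positive (1 [ lit 0 ] ⊕ acceptable)))
    σ₄ = write σ₃ 7 0 (suc (σ 7 0))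

    bounded₁ : Bounded L σ₁
    bounded₁ = write-bounded 3 (eval σ extended)
      (sgn (σ 3 (eval σ extended) + eval σ extendable))
      bounded (mark-fits (σ 3 (eval σ extended) + eval σ extendable))

    bounded₂ : Bounded L σ₂
    bounded₂ = write-bounded 3 (eval σ₁ closed)
      (sgn (σ₁ 3 (eval σ₁ closed) + eval σ₁ closable))
      bounded₁ (mark-fits (σ₁ 3 (eval σ₁ closed) + eval σ₁ closable))

    bounded₃ : Bounded L σ₃
    bounded₃ = write-bounded 1 0 (sgn (σ₂ 1 0 + eval σ₂ acceptable)) bounded₂
      (mark-fits (σ₂ 1 0 + eval σ₂ acceptable))

    bounded₄ : Bounded L σ₄
    bounded₄ = write-bounded 7 0 (suc (σ 7 0)) bounded₃
      (≤-trans (len-mono (subst (λ i → suc i ≤ iterations I) (sym counter) i<N)) len₃)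

    stage≡ : σ 7 0 ≡ stage k S w v a b
    stage≡ = trans counter i≡

    module T₀ = Transition I σ reads powers {k} {S} {w} {v} {a} {b} stage≡
    module T₁ = Transition I σ₁ reads powers {k} {S} {w} {v} {a} {b} stage≡
    module T₂ = Transition I σ₂ reads powers {k} {S} {w} {v} {a} {b} stage≡

    sound₁ : Sound I (σ₁ 3)
    sound₁ = marked-sound I {σ 3} sound λ c≢0 →
      let src≢0 , wa , a∉S = T₀.extendable⁻ c≢0 in
      suc k , S ▸ a , a , v , T₀.extended≡ a∉S , extend (sound src≢0) a∉S wa

    sound₂ : Sound I (σ₂ 3)
    sound₂ = marked-sound I {σ₁ 3} sound₁ λ c≢0 →
      let src≢0 , wv , a∈S , b∈S = T₁.closable⁻ c≢0 in
      suc k , S , a , b , T₁.closed≡ , close (sound₁ src≢0) wv a∈S b∈S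

    grow₁ : ∀ {j} → σ 3 j ≢ 0 → σ₁ 3 j ≢ 0
    grow₁ = marked-grow (σ 3) (eval σ extended) (eval σ extendable)

    grow₂ : ∀ {j} → σ₁ 3 j ≢ 0 → σ₂ 3 j ≢ 0
    grow₂ = marked-grow (σ₁ 3) (eval σ₁ closed) (eval σ₁ closable)

    grow₃ : σ 1 0 ≢ 0 → σ₃ 1 0 ≢ 0
    grow₃ = sgn≢0⁺ ∘ +≢0ˡ (eval σ₂ acceptable)

    source : Der A k S w v → σ 3 (code k S w v) ≢ 0
    source = reached I complete a b i≡

    complete′ : Complete I (suc i) (σ₂ 3) (σ₃ 1 0)
    complete′ = record
      { started  = λ r → grow₂ (grow₁ (Complete.started complete r))
      ; extends  = extends
      ; closes   = closes
      ; accepted = accepted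
      }
      where
      extends : ∀ {k S w v a b} → stage k S w v a b < suc i → Der A k S w v →
                a ∉ S → Arc A w a → σ₂ 3 (code (suc k) (S ▸ a) a v) ≢ 0
      extends {k′} {S′} {w′} {v′} {a′} {b′} j< d a∉S wa with m<1+n⇒m<n∨m≡n j<
      ... | inj₁ j<i = grow₂ (grow₁ (Complete.extends complete {b = b′} j<i d a∉S wa))
      ... | inj₂ j≡i
        with stage-injective {k = k′} {k} {S′} {S} {w′} {w} {v′} {v} {a′} {a} {b′} {b}
               (trans j≡i i≡)
      ... | refl , refl , refl , refl , refl , refl =
        grow₂ (subst (λ j → σ₁ 3 j ≢ 0) (T₀.extended≡ a∉S)
          (marked-hit (σ 3) (eval σ extended) (T₀.extendable⁺ (source d) wa a∉S)))

      closes : ∀ {k S w v a b} → stage k S w v a b < suc i → Der A k S w v →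
               Arc A w v → a ∈ S → b ∈ S → σ₂ 3 (code (suc k) S a b) ≢ 0
      closes {k′} {S′} {w′} {v′} {a′} {b′} j< d wv a∈S b∈S with m<1+n⇒m<n∨m≡n j<
      ... | inj₁ j<i = grow₂ (grow₁ (Complete.closes complete j<i d wv a∈S b∈S))
      ... | inj₂ j≡i
        with stage-injective {k = k′} {k} {S′} {S} {w′} {w} {v′} {v} {a′} {a} {b′} {b}
               (trans j≡i i≡)
      ... | refl , refl , refl , refl , refl , refl =
        subst (λ j → σ₂ 3 j ≢ 0) T₁.closed≡
          (marked-hit (σ₁ 3) (eval σ₁ closed) (T₁.closable⁺ (grow₁ (source d)) wv a∈S b∈S))

      accepted : ∀ {k S w a b} → stage k S w w a b < suc i → Der A k S w w →
                 Term ⊆ S → + k ℤ.≤ budget I → σ₃ 1 0 ≢ 0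
      accepted {k′} {S′} {w′} {a′} {b′} j< d T⊆S k≤b with m<1+n⇒m<n∨m≡n j<
      ... | inj₁ j<i = grow₃ (Complete.accepted complete {a = a′} {b′} j<i d T⊆S k≤b)
      ... | inj₂ j≡i
        with stage-injective {k = k′} {k} {S′} {S} {w′} {w} {w′} {v} {a′} {a} {b′} {b}
               (trans j≡i i≡)
      ... | refl , refl , refl , refl , refl , refl =
        sgn≢0⁺ (+≢0ʳ (σ₂ 1 0)
          (T₂.acceptable⁺ (grow₂ (grow₁ (source d))) refl (covered⁻ T⊆S) k≤b))

    yes′ : σ₃ 1 0 ≢ 0 → HasSolution I
    yes′ ≢0 with +≢0⁻ (sgn≢0⁻ ≢0)
    ... | inj₁ old = affirms old
    ... | inj₂ new with T₂.acceptable⁻ new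
    ... | src≢0 , refl , cov , k≤b =
      accepting⇒solution I (k , S , w , sound₂ src≢0 , covered cov , k≤b)

    inv′ : Inv₃ (suc i) σ₄
    inv′ = record
      { isBase   = record
        { bounded = bounded₄
        ; reads   = reads
        ; sound   = sound₂
        ; binary  = sgn≤1 (σ₂ 1 0 + eval σ₂ acceptable)
        ; affirms = yes′
        ; trivial = λ n≡0 sol → grow₃ (trivial n≡0 sol)
        }
      ; powers   = powers
      ; counter  = cong suc counter
      ; covered  = covered
      ; covered⁻ = covered⁻
      ; complete = complete′
      }

  step₁ : ∀ {i σ} → i < n → Inv₁ i σ → Run L body₁ σ (bodyPrice body₁) (Inv₁ (suc i))
  step₁ {i} {σ} i<n inv =
    run-seq (run-assign {Q = _≡ σ₁} 0<L bounded refl) λ { refl →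
    run-seq (run-assign {Q = _≡ σ₂} 0<L bounded₁ refl) λ { refl →
    run-assign 0<L bounded₂ inv′ }}
    where
    open Inv₁ inv
    open Base isBase

    t = eval σ singletonᴱ

    σ₁ = write σ 3 t (sgn (σ 3 t + 1))
    σ₂ = write σ₁ 2 (suc (σ 5 0)) (2 * σ 2 (σ 5 0))
    σ₃ = write σ₂ 5 0 (suc (σ 5 0))

    r₀ : Fin n
    r₀ = fromℕ< i<n

    counter≡ : σ 5 0 ≡ toℕ r₀
    counter≡ = trans counter (sym (Fin.toℕ-fromℕ< i<n))

    power≡ : σ 2 (σ 5 0) ≡ 2 ^ i
    power≡ = trans (cong (σ 2) counter) (powers ≤-refl)

    t≡ : t ≡ code 0 ⁅ r₀ ⁆ r₀ r₀
    t≡ = cong₂ (λ m x → m + x)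
      (cong₂ _*_ (cong₂ _+_ (cong₂ _*_ mask≡ vertices≡) counter≡) vertices≡) counter≡
      where
      open Reads reads

      mask≡ : σ 2 (σ 5 0) ≡ mask ⁅ r₀ ⁆
      mask≡ = trans power≡
        (trans (cong (2 ^_) (sym (Fin.toℕ-fromℕ< i<n))) (sym (mask-⁅⁆ r₀)))

    bounded₁ : Bounded L σ₁
    bounded₁ = write-bounded 3 t (sgn (σ 3 t + 1)) bounded (mark-fits (σ 3 t + 1))

    bounded₂ : Bounded L σ₂
    bounded₂ = write-bounded 2 (suc (σ 5 0)) (2 * σ 2 (σ 5 0)) bounded₁
      (subst (λ p → len (2 * p) ≤ L) (sym power≡) (power-fits i<n))

    bounded₃ : Bounded L σ₃
    bounded₃ = write-bounded 5 0 (suc (σ 5 0)) bounded₂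
      (≤-trans (len-mono (subst (λ i → suc i ≤ n) (sym counter) i<n)) len₁)

    sound₁ : Sound I (σ₁ 3)
    sound₁ = marked-sound I {σ 3} sound λ _ → 0 , ⁅ r₀ ⁆ , r₀ , r₀ , t≡ , start r₀

    powers′ : Powers I (suc i) (σ₃ 2)
    powers′ {x} x≤1+i with m≤n⇒m<n∨m≡n x≤1+i
    ... | inj₁ x<1+i = trans
      (updated-other (σ 2) (2 * σ 2 (σ 5 0))
        (λ x≡ → <-irrefl (trans x≡ (cong suc counter)) x<1+i))
      (powers (s≤s⁻¹ x<1+i))
    ... | inj₂ refl = trans
      (cong (λ j → σ₂ 2 (suc j)) (sym counter))
      (trans (updated-same (σ 2) (suc (σ 5 0)) (2 * σ 2 (σ 5 0))) (cong (2 *_) power≡))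

    started′ : ∀ r → toℕ r < suc i → σ₁ 3 (code 0 ⁅ r ⁆ r r) ≢ 0
    started′ r r<1+i with m<1+n⇒m<n∨m≡n r<1+i
    ... | inj₁ r<i = marked-grow (σ 3) t 1 (started r r<i)
    ... | inj₂ r≡i = subst (λ j → σ₁ 3 j ≢ 0)
      (trans t≡ (cong (λ r → code 0 ⁅ r ⁆ r r) (sym r≡r₀)))
      (marked-hit (σ 3) t (λ ()))
      where
      r≡r₀ : r ≡ r₀
      r≡r₀ = Fin.toℕ-injective (trans r≡i (sym (Fin.toℕ-fromℕ< i<n)))

    inv′ : Inv₁ (suc i) σ₃
    inv′ = record
      { isBase  = record
        { bounded = bounded₃
        ; reads   = reads
        ; sound   = sound₁
        ; binary  = binary
        ; affirms = affirms
        ; trivial = trivial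
        }
      ; powers  = powers′
      ; started = started′
      ; counter = cong suc counter
      ; zero₄   = zero₄
      ; zero₆   = zero₆
      ; zero₇   = zero₇
      }

  module _ (σ : Store) (reads : Reads I (σ 0)) (powers : Powers I n (σ 2))
           {S : Subset n} {t : Fin n} (counter : σ 6 0 ≡ mask S * n + toℕ t) where
    open Reads reads

    mask≡ : eval σ (var 6 ⊘ vertices) ≡ mask S
    mask≡ = eval-⊘ σ (var 6) vertices (mask S) counter vertices≡ (Fin.toℕ<n t)

    private
      t≡ : eval σ (var 6 mod vertices) ≡ toℕ t
      t≡ = eval-mod σ (var 6) vertices (mask S) counter vertices≡ (Fin.toℕ<n t)

      digit-t≡ : eval σ (digit (var 6 ⊘ vertices) (var 6 mod vertices)) ≡ bit (lookup S t)
      digit-t≡ = digit≡ I σ powers (var 6 ⊘ vertices) (var 6 mod vertices) S t mask≡ t≡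

      terminal-t≡ : eval σ (isTerminal (var 6 mod vertices)) ≡ bit (lookup Term t)
      terminal-t≡ = trans (cong (λ j → σ 0 (3 + j)) t≡) (terminal≡ t)

    opaque
      unfolding uncovered

      uncovered⁻ : eval σ uncovered ≢ 0 → t ∈ Term × t ∉ S
      uncovered⁻ ≢0 with *≢0⁻ ≢0
      ... | t∈ , t∉ = bit≢0⁻ (≢0-resp (sym terminal-t≡) t∈) ,
        bit≡0⁻ (trans (sym digit-t≡) (1∸≢0⁻ t∉))

      uncovered⁺ : t ∈ Term → t ∉ S → eval σ uncovered ≢ 0
      uncovered⁺ t∈ t∉ = *≢0⁺ (≢0-resp terminal-t≡ (bit≢0⁺ t∈))
        (1∸≢0⁺ (trans digit-t≡ (bit≡0⁺ t∉)))

  step₂ : ∀ {i σ} → i < 2 ^ n * n → Inv₂ i σ → Run L body₂ σ (bodyPrice body₂) (Inv₂ (suc i))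
  step₂ {i} {σ} i< inv with unpair (2 ^ n) i<
  ... | q , t , q< , i≡qt with unmask n q<
  ... | S , refl =
    run-seq (run-assign {Q = _≡ σ₁} 0<L bounded refl) λ { refl →
    run-assign 0<L bounded₁ inv′ }
    where
    open Inv₂ inv
    open Base isBase

    d = eval σ (var 6 ⊘ vertices)
    c = eval σ uncovered

    σ₁ = write σ 4 d (sgn (σ 4 d + c))
    σ₂ = write σ₁ 6 0 (suc (σ 6 0))

    counter≡ : σ 6 0 ≡ mask S * n + toℕ t
    counter≡ = trans counter i≡qt

    d≡ : d ≡ mask S
    d≡ = mask≡ σ reads powers {S} {t} counter≡

    bounded₁ : Bounded L σ₁
    bounded₁ = write-bounded 4 d (sgn (σ 4 d + c)) bounded (mark-fits (σ 4 d + c))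

    bounded₂ : Bounded L σ₂
    bounded₂ = write-bounded 6 0 (suc (σ 6 0)) bounded₁
      (≤-trans (len-mono (subst (λ i → suc i ≤ 2 ^ n * n) (sym counter) i<)) len₂)

    flagged′ : ∀ {S : Subset n} {t} → mask S * n + toℕ t < suc i →
      t ∈ Term → t ∉ S → σ₁ 4 (mask S) ≢ 0
    flagged′ {S′} {t′} j< t∈ t∉ with m<1+n⇒m<n∨m≡n j<
    ... | inj₁ j<i = marked-grow (σ 4) d c (flagged j<i t∈ t∉)
    ... | inj₂ j≡i with pair-injective {n} {mask S′} {toℕ t′} {mask S} {toℕ t}
                          (Fin.toℕ<n t′) (Fin.toℕ<n t) (trans j≡i i≡qt)
    ... | S≡ , t≡ with mask-injective {S = S′} {S} S≡ | Fin.toℕ-injective t≡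
    ... | refl | refl = subst (λ j → σ₁ 4 j ≢ 0) d≡
      (marked-hit (σ 4) d (uncovered⁺ σ reads powers {S} {t} counter≡ t∈ t∉))

    flagged⁻′ : ∀ {S : Subset n} → σ₁ 4 (mask S) ≢ 0 → ¬ (Term ⊆ S)
    flagged⁻′ {S′} ≢0 T⊆S′ with marked⁻ (σ 4) d c {mask S′} ≢0
    ... | inj₁ old          = flagged⁻ old T⊆S′
    ... | inj₂ (S≡d , c≢0) with mask-injective {S = S′} {S} (trans S≡d d≡)
                             | uncovered⁻ σ reads powers {S} {t} counter≡ c≢0
    ... | refl | t∈ , t∉ = t∉ (T⊆S′ t∈)

    inv′ : Inv₂ (suc i) σ₂
    inv′ = record
      { isBase   = record
        { bounded = bounded₂
        ; reads   = reads
        ; sound   = sound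
        ; binary  = binary
        ; affirms = affirms
        ; trivial = trivial
        }
      ; powers   = powers
      ; started  = started
      ; counter  = cong suc counter
      ; flagged  = λ {S} {t} → flagged′ {S} {t}
      ; flagged⁻ = λ {S} → flagged⁻′ {S}
      ; zero₇    = zero₇
      }

  no-vertices : n ≡ 0 → signOf (budget I) ≡ 0 → HasSolution I
  no-vertices n≡0 sign≡0 = Vec.replicate n ⊥ , (λ u → ⊥-elim ∘ Arc-⊥) ,
    subst (λ m → + m ℤ.≤ budget I) (sym (∣⊥∣ᴬ≡0 n n))
      (⇒+≤ (budget I) (0∸n≡0 ℤ.∣ budget I ∣) sign≡0) ,
    λ u → contradiction (subst Fin n≡0 u) λ ()

  prepared : Run L prepare (initial (encodeSteiner I)) (bodyPrice prepare) (Inv₁ 0)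
  prepared =
    run-seq (run-assign {Q = _≡ σ₁} 0<L bounded₀ refl) λ { refl →
    run-assign 0<L bounded₁ inv }
    where
    σ₀ = initial (encodeSteiner I)
    σ₁ = write σ₀ 2 0 1
    a₀ = (1 ∸ σ₀ 0 0) * (1 ∸ σ₀ 0 1)
    σ₂ = write σ₁ 1 0 a₀

    open Reads (reads-initial I)

    bounded₀ : Bounded L σ₀
    bounded₀ zero    i = input≤ i
    bounded₀ (suc a) i = bit-fits z≤n

    bounded₁ : Bounded L σ₁
    bounded₁ = write-bounded 2 0 1 bounded₀ (bit-fits ≤-refl)

    a₀≤1 : a₀ ≤ 1
    a₀≤1 = *-mono-≤ (m∸n≤m 1 (σ₀ 0 0)) (m∸n≤m 1 (σ₀ 0 1))

    affirms₀ : a₀ ≢ 0 → HasSolution I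
    affirms₀ ≢0 with *≢0⁻ {1 ∸ σ₀ 0 0} {1 ∸ σ₀ 0 1} ≢0
    ... | n≢0 , s≢0 = no-vertices (1∸≢0⁻ n≢0) (trans (sym sign≡) (1∸≢0⁻ s≢0))

    trivial₀ : n ≡ 0 → HasSolution I → a₀ ≢ 0
    trivial₀ n≡0 (_ , _ , ∣X∣≤b , _) =
      *≢0⁺ (1∸≢0⁺ n≡0) (1∸≢0⁺ (trans sign≡ (proj₂ (+≤⇒ ∣X∣≤b))))

    inv : Inv₁ 0 σ₂
    inv = record
      { isBase  = record
        { bounded = write-bounded 1 0 a₀ bounded₁ (bit-fits a₀≤1)
        ; reads   = reads-initial I
        ; sound   = λ ≢0 → contradiction refl ≢0
        ; binary  = a₀≤1
        ; affirms = affirms₀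
        ; trivial = trivial₀
        }
      ; powers  = λ { z≤n → refl }
      ; started = λ r ()
      ; counter = refl
      ; zero₄   = λ j → refl
      ; zero₆   = refl
      ; zero₇   = refl
      }

  inv₁⇒inv₂ : ∀ {σ} → Inv₁ n σ → Inv₂ 0 σ
  inv₁⇒inv₂ inv = record
    { isBase   = isBase
    ; powers   = powers
    ; started  = λ r → started r (Fin.toℕ<n r)
    ; counter  = zero₆
    ; flagged  = λ ()
    ; flagged⁻ = λ {S} ≢0 → contradiction (zero₄ (mask S)) ≢0
    ; zero₇    = zero₇
    }
    where open Inv₁ inv

  inv₂⇒inv₃ : ∀ {σ} → Inv₂ (2 ^ n * n) σ → Inv₃ 0 σ
  inv₂⇒inv₃ {σ} inv = record
    { isBase   = isBase
    ; powers   = powers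
    ; counter  = zero₇
    ; covered  = λ {S} → covered {S}
    ; covered⁻ = λ {S} → covered⁻ {S}
    ; complete = record
      { started  = started
      ; extends  = λ ()
      ; closes   = λ ()
      ; accepted = λ ()
      }
    }
    where
    open Inv₂ inv

    covered : ∀ {S : Subset n} → σ 4 (mask S) ≡ 0 → Term ⊆ S
    covered {S} ≡0 {t} t∈ with t ∈? S
    ... | yes t∈S = t∈S
    ... | no  t∉S = contradiction ≡0 (flagged (pair< (mask< S) (Fin.toℕ<n t)) t∈ t∉S)

    covered⁻ : ∀ {S : Subset n} → Term ⊆ S → σ 4 (mask S) ≡ 0
    covered⁻ {S} T⊆S with σ 4 (mask S) ≟ 0
    ... | yes ≡0 = ≡0
    ... | no  ≢0 = ⊥-elim (flagged⁻ ≢0 T⊆S)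

  Verdict : Store → Set
  Verdict σ = (answer σ ≡ 1 × HasSolution I) ⊎ (answer σ ≡ 0 × ¬ HasSolution I)

  inv₃⇒verdict : ∀ {σ} → Inv₃ (iterations I) σ → Verdict σ
  inv₃⇒verdict {σ} inv with σ 1 0 ≟ 0
  ... | no  ≢0 = inj₁ (≤-antisym binary (n≢0⇒n>0 ≢0) , affirms ≢0)
    where
    open Inv₃ inv
    open Base isBase
  ... | yes ≡0 = inj₂ (≡0 , λ sol → detected sol ≡0)
    where
    open Inv₃ inv
    open Base isBase

    detected : HasSolution I → σ 1 0 ≢ 0
    detected sol with n ≟ 0
    ... | yes n≡0 = trivial n≡0 sol
    ... | no  n≢0 with solution⇒accepting I (fromℕ< (n≢0⇒n>0 n≢0)) sol
    ... | k , k≤n² , S , w , d , T⊆S , k≤b =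
      -- A state is tested for acceptance at each of its stages, so any a and b will do; the bound
      -- on k puts this stage within the sweep.
      Complete.accepted complete {a = w} {b = w}
        (stage< (suc (n * n)) S w w w w (s≤s k≤n²)) d T⊆S k≤b

  run-steiner : Run L steiner (initial (encodeSteiner I))
    (bodyPrice prepare +
      (suc n * (testPrice test₁ + bodyPrice body₁) +
        (suc (2 ^ n * n) * (testPrice test₂ + bodyPrice body₂) +
          suc (iterations I) * (testPrice test₃ + bodyPrice body₃))))
    Verdict
  run-steiner =
    run-seq prepared λ inv₁ →
    run-seq (run-while n Inv₁ 0<L (Base.bounded ∘ Inv₁.isBase) eval-test₁ step₁ inv₁) λ inv₁ →
    run-seq (run-while (2 ^ n * n) Inv₂ 0<L (Base.bounded ∘ Inv₂.isBase) eval-test₂ step₂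
      (inv₁⇒inv₂ inv₁)) λ inv₂ →
    weaken inv₃⇒verdict
      (run-while (iterations I) Inv₃ 0<L (Base.bounded ∘ Inv₃.isBase) eval-test₃ step₃
        (inv₂⇒inv₃ inv₂))
    where
    eval-test₁ : ∀ {i σ} → Inv₁ i σ → eval σ test₁ ≡ n ∸ i
    eval-test₁ inv = cong₂ _∸_ (Reads.vertices≡ (Base.reads isBase)) counter
      where open Inv₁ inv

    eval-test₂ : ∀ {i σ} → Inv₂ i σ → eval σ test₂ ≡ 2 ^ n * n ∸ i
    eval-test₂ {σ = σ} inv = cong₂ _∸_
      (cong₂ _*_ (trans (cong (σ 2) vertices≡) (powers ≤-refl)) vertices≡) counter
      where
      open Inv₂ inv
      open Reads (Base.reads isBase)

    eval-test₃ : ∀ {i σ} → Inv₃ i σ → eval σ test₃ ≡ iterations I ∸ i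
    eval-test₃ {σ = σ} inv = cong₂ _∸_ total counter
      where
      open Inv₃ inv
      open Reads (Base.reads isBase)

      total : suc (σ 0 0 * σ 0 0) * σ 2 (σ 0 0) * σ 0 0 * σ 0 0 * σ 0 0 * σ 0 0 ≡ iterations I
      total rewrite vertices≡ | powers {n} ≤-refl = refl

-- The total running time

module Size (I : SteinerInstance) where

  n s L : ℕ
  n = order I
  s = suc (Problem.size SCSS I)
  -- In units of s, the length of the iteration count is at most 3 for 1 + n², 1 for the power of
  -- two and 1 for each of the four factors n.
  L = 8 * s

  -- The terminals alone contribute n entries, each at least one bit long. Hence 2 ^ n, a number
  -- with n + 1 digits, is no longer than s.
  order<s : n < s
  order<s = s≤s (≤-trans n≤length (length≤size (encodeSteiner I)))
    where
    bits = toList (terminals I) ++ toList (Vec.concat (arcs I))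

    n≤length : n ≤ List.length (encodeSteiner I)
    n≤length = begin
      n                                  ≡⟨ Vec.length-toList (terminals I) ⟨
      List.length (toList (terminals I)) ≤⟨ m≤m+n _ _ ⟩
      List.length (toList (terminals I)) + List.length (toList (Vec.concat (arcs I)))
                                         ≡⟨ List.length-++ (toList (terminals I)) ⟨
      List.length bits                   ≡⟨ List.length-map bit bits ⟨
      List.length (List.map bit bits)    ≤⟨ m≤n+m _ 3 ⟩
      3 + List.length (List.map bit bits)
        ≡⟨ cong (suc ∘ List.length) (encodeℤ-++ (budget I) (List.map bit bits)) ⟨
      List.length (encodeSteiner I)      ∎
      where open ≤-Reasoning

  s≤L : s ≤ L
  s≤L = m≤n*m s 8

  len-n≤s : len n ≤ s
  len-n≤s = len-nth≤ (encodeSteiner I) 0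

  len-2^n≤s : len (2 ^ n) ≤ s
  len-2^n≤s = ≤-trans (≤-reflexive (cong suc (⌊log₂[2^n]⌋≡n n))) order<s

  len-*≤ : ∀ i j {a b} → len a ≤ i * s → len b ≤ j * s → len (a * b) ≤ (i + j) * s
  len-*≤ i j {a} {b} a≤ b≤ = ≤-trans (len-* a b)
    (≤-trans (+-mono-≤ a≤ b≤) (≤-reflexive (sym (*-distribʳ-+ s i j))))

  ≤1*s : ∀ {m} → m ≤ s → m ≤ 1 * s
  ≤1*s m≤s = ≤-trans m≤s (≤-reflexive (sym (*-identityˡ s)))

  len₂ : len (2 ^ n * n) ≤ L
  len₂ = ≤-trans (len-*≤ 1 1 {2 ^ n} {n} (≤1*s len-2^n≤s) (≤1*s len-n≤s))
    (*-monoˡ-≤ s {2} {8} (s≤s (s≤s z≤n)))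

  len₃ : len (iterations I) ≤ L
  len₃ =
    step 7 (m * n * n * n) (step 6 (m * n * n) (step 5 (m * n) (step 4 m
      (len-*≤ 3 1 {suc (n * n)} {2 ^ n} len-1+n² (≤1*s len-2^n≤s)))))
    where
    m = suc (n * n) * 2 ^ n

    step : ∀ i a → len a ≤ i * s → len (a * n) ≤ (i + 1) * s
    step i a a≤ = len-*≤ i 1 {a} {n} a≤ (≤1*s len-n≤s)

    len-1+n² : len (suc (n * n)) ≤ 3 * s
    len-1+n² = ≤-trans (len-+ 1 (n * n))
      (+-mono-≤ {len 1} {s} {len (n * n)} {2 * s} (s≤s z≤n)
        (len-*≤ 1 1 {n} {n} (≤1*s len-n≤s) (≤1*s len-n≤s)))

  0<L : 0 < L
  0<L = ≤-trans z<s s≤L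

  input≤ : ∀ i → len (nth (encodeSteiner I) i) ≤ L
  input≤ i = ≤-trans (len-nth≤ (encodeSteiner I) i) s≤L

  order<L : n < L
  order<L = <-≤-trans order<s s≤L

  len₁ : len n ≤ L
  len₁ = ≤-trans len-n≤s s≤L

  -- The exponent 6 stems from the main loop: 1 + n² is at most s ^ 2, and the four factors n
  -- contribute s ^ 4.
  scale : ℕ
  scale = 2 ^ n * s ^ 6

  0<2^n : 0 < 2 ^ n
  0<2^n = m^n>0 2 n

  s≤s^6 : s ≤ s ^ 6
  s≤s^6 = m≤m*n s (s ^ 5) {{m^n≢0 s 5}}

  n≤ : suc n ≤ scale
  n≤ = ≤-trans order<s (≤-trans s≤s^6 (m≤n*m (s ^ 6) (2 ^ n) {{>-nonZero 0<2^n}}))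

  2^n*n≤ : suc (2 ^ n * n) ≤ scale
  2^n*n≤ = begin
    suc (2 ^ n * n)   ≤⟨ +-monoˡ-≤ (2 ^ n * n) 0<2^n ⟩
    2 ^ n + 2 ^ n * n ≡⟨ *-suc (2 ^ n) n ⟨
    2 ^ n * suc n     ≤⟨ *-monoʳ-≤ (2 ^ n) (≤-trans order<s s≤s^6) ⟩
    scale             ∎
    where open ≤-Reasoning

  1≤scale : 1 ≤ scale
  1≤scale = ≤-trans (s≤s z≤n) n≤

  iterations≤ : suc (iterations I) ≤ 2 * scale
  -- The final test of the loop takes the second copy of `scale`, which explains the coefficient 2
  -- of `iterationCost₃` in `constant`.
  iterations≤ = +-mono-≤ 1≤scale (begin
    suc (n * n) * 2 ^ n * n * n * n * n
      ≤⟨ step (step (step (step (*-monoˡ-≤ (2 ^ n) 1+n²≤s²)))) ⟩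
    s * s * 2 ^ n * s * s * s * s       ≡⟨ rearrange s (2 ^ n) ⟩
    2 ^ n * s ^ 6 + 0                   ∎)
    where
    open ≤-Reasoning

    step : ∀ {p q} → p ≤ q → p * n ≤ q * s
    step p≤q = *-mono-≤ p≤q (<⇒≤ order<s)

    1+n²≤s² : suc (n * n) ≤ s * s
    1+n²≤s² = *-mono-< order<s order<s

    rearrange : ∀ s p →
      s * s * p * s * s * s * s ≡ p * (s * (s * (s * (s * (s * (s * 1)))))) + 0
    rearrange = solve-∀

prepareCost iterationCost₁ iterationCost₂ iterationCost₃ constant : ℕ
prepareCost    = bodyPrice prepare
iterationCost₁ = testPrice test₁ + bodyPrice body₁
iterationCost₂ = testPrice test₂ + bodyPrice body₂
iterationCost₃ = testPrice test₃ + bodyPrice body₃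
constant       = prepareCost + (iterationCost₁ + (iterationCost₂ + 2 * iterationCost₃))

bound : ∀ {X u v w} p a b c → 1 ≤ X → u ≤ X → v ≤ X → w ≤ 2 * X →
  p + (u * a + (v * b + w * c)) ≤ X * (p + (a + (b + 2 * c)))
bound {X} {u} {v} {w} p a b c 1≤X u≤ v≤ w≤ = begin
  p + (u * a + (v * b + w * c))             ≤⟨ +-mono-≤ (m≤n*m p X {{>-nonZero 1≤X}})
    (+-mono-≤ (*-monoˡ-≤ a u≤) (+-mono-≤ (*-monoˡ-≤ b v≤) (*-monoˡ-≤ c w≤))) ⟩
  X * p + (X * a + (X * b + 2 * X * c))     ≡⟨ rearrange X p a b c ⟩
  X * (p + (a + (b + 2 * c)))               ∎
  where
  open ≤-Reasoning
  rearrange : ∀ X p a b c → X * p + (X * a + (X * b + 2 * X * c)) ≡ X * (p + (a + (b + 2 * c)))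
  rearrange = solve-∀

theorem2 : SolvableInTimeO* SCSS (λ I → 2 ^ order I)
theorem2 = steiner , constant * 8 , 7 , decides
  where
  decides : DecidesInTime SCSS steiner _
  -- The seventh factor s and the factor 8 come from the unit of time, L = 8 * s.
  decides I = within (Loops.run-steiner I L 0<L input≤ order<L len₁ len₂ len₃)
    (≤-trans (*-monoˡ-≤ L total≤) (≤-reflexive (rearrange (2 ^ n) (s ^ 6) constant s)))
    where
    open Size I

    total≤ : prepareCost + (suc n * iterationCost₁ + (suc (2 ^ n * n) * iterationCost₂ +
               suc (iterations I) * iterationCost₃)) ≤ scale * constant
    total≤ = bound prepareCost iterationCost₁ iterationCost₂ iterationCost₃
      1≤scale n≤ 2^n*n≤ iterations≤

    rearrange : ∀ p q c s → p * q * c * (8 * s) ≡ p * (c * 8 * (s * q))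
    rearrange = solve-∀
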